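{- Let $d\geq 1$ be a (standard) natural number, let $H\in{}^{\ast}\mathbb{N}\setminus\mathbb{N}$, let $U$ be a cut in $[1,H]$, and let $E$ be an internal subset of $[-H,H]^{d}$. Then $$\mu_{[-H,H]^{d}}\left(\left\{x\in E+\mathcal{U}^{d}: d_{E}(x)<1\right\}\right)=0,$$ where $\mathcal{U}=(-U)\cup\{0\}\cup U$ and $d_E(x)=\liminf_{\nu>U}\mu_{x+[-\nu,\nu]^d}\left((E+\mathcal{U}^d)\cap(x+[-\nu,\nu]^d)\right)$.
   Context: We work in a countably saturated nonstandard universe. $\mathbb{N}$ does not contain $0$, and intervals denote intervals in ${}^{\ast}\mathbb{Z}$. Loeb measure: for a nonempty internal hyperfinite set $F\subseteq{}^{\ast}\mathbb{Z}^d$ and internal $D\subseteq F$, $\mu_F(D)=\operatorname{st}(|D|/|F|)$ (with $|\cdot|$ internal cardinality and $\operatorname{st}$ the standard part); $\mu_F$ also denotes its canonical extension to the complete countably additive Loeb probability measure on the $\sigma$-algebra of Loeb measurable subsets of $F$. If $D\not\subseteq F$, $\mu_F(D)$ means $\mu_F(D\cap F)$. A cut $U$ in $[1,H]$ is a (nonempty) initial segment of $[1,H]$ that is closed under addition. Writing $\nu>U$ means $\nu>u$ for all $u\in U$. For a real-valued function $g$, $\liminf_{\nu>U}g(\nu)$ means $\sup_{\xi>U}\inf_{U<\nu<\xi}g(\nu)$, where $\xi,\nu$ range over hypernatural numbers. -}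

module Defs where

open import Axiom.ExcludedMiddle using (ExcludedMiddle)
open import Data.Bool.Base using (Bool; T)
open import Data.Empty using (⊥)
open import Data.Fin.Base using (Fin)
open import Data.Integer.Base as ℤ using (ℤ; +_)
import Data.Integer.Properties as ℤ
open import Data.List.Base using (List; []; _∷_)
open import Data.List.Membership.Propositional using () renaming (_∈_ to _∈ˡ_)
open import Data.List.Relation.Unary.All as All using (All; []; _∷_)
open import Data.Nat.Base as ℕ using (ℕ; zero; suc)
open import Data.Product using (Σ; Σ-syntax; ∃; ∃-syntax; _×_; _,_; proj₁; proj₂)
open import Data.Rational.Base as ℚ using (ℚ; ↥_; ↧_; 0ℚ; 1ℚ)
import Data.Rational.Properties as ℚ
open import Data.Sum.Base using (_⊎_)
open import Data.Vec.Base as Vec using (Vec)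
import Data.Vec.Relation.Binary.Pointwise.Inductive as Pointwise
open import Function.Base using (_∘_)
open import Function.Bundles using (_⇔_; _↔_)
open import Level using (0ℓ)
open import Relation.Binary.PropositionalEquality using (_≡_)
open import Relation.Nullary using (¬_; yes; no)
open import Relation.Nullary.Decidable using (⌊_⌋; _×-dec_)
open import Relation.Unary using (Pred; _∩_; _∖_)

-- A nonstandard universe is taken over the full finite-type hierarchy above
-- the set of atoms ℤ (the type-theoretic form of a superstructure; rationals
-- and reals occur at higher types).  P σ is the power set of σ.

infixr 5 _⇒_
infixl 7 _^_

data Ty : Set where
  ι   : Ty
  _⊗_ : Ty → Ty → Ty
  _^_ : Ty → ℕ → Ty
  _⇒_ : Ty → Ty → Ty
  P   : Ty → Ty

-- Subsets are Bool-valued so that the hierarchy stays in Set; under excluded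
-- middle these are all subsets.

⟦_⟧ : Ty → Set
⟦ ι ⟧     = ℤ
⟦ σ ⊗ τ ⟧ = ⟦ σ ⟧ × ⟦ τ ⟧
⟦ σ ^ n ⟧ = Vec ⟦ σ ⟧ n
⟦ σ ⇒ τ ⟧ = ⟦ σ ⟧ → ⟦ τ ⟧
⟦ P σ ⟧   = ⟦ σ ⟧ → Bool

-- Only application and membership are primitive: pairing, projections,
-- coordinates, arithmetic, ... are constants naming standard objects.

infixl 20 _·_
infix  10 _≐_ _∊_
infixr 8 _∧_
infixr 7 _∨_
infixr 6 _⊃_

data Term (Γ : List Ty) : Ty → Set where
  var : ∀ {σ} → σ ∈ˡ Γ → Term Γ σ
  con : ∀ σ → ⟦ σ ⟧ → Term Γ σ
  _·_ : ∀ {σ τ} → Term Γ (σ ⇒ τ) → Term Γ σ → Term Γ τ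

-- Quantification over a type is bounded quantification in the superstructure.

data Formula (Γ : List Ty) : Set where
  _≐_     : ∀ {σ} → Term Γ σ → Term Γ σ → Formula Γ
  _∊_     : ∀ {σ} → Term Γ σ → Term Γ (P σ) → Formula Γ
  ⊥′      : Formula Γ
  _∧_ _∨_ _⊃_ : Formula Γ → Formula Γ → Formula Γ
  all′ ex′ : ∀ σ → Formula (σ ∷ Γ) → Formula Γ

record Structure : Set₁ where
  infixl 20 _∙_
  infix  4 _∈_
  field
    El   : Ty → Set
    name : ∀ σ → ⟦ σ ⟧ → El σ
    _∙_  : ∀ {σ τ} → El (σ ⇒ τ) → El σ → El τ
    _∈_  : ∀ {σ} → El σ → El (P σ) → Set

  eval : ∀ {Γ σ} → All El Γ → Term Γ σ → El σ
  eval ρ (var x)   = All.lookup ρ x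
  eval ρ (con σ c) = name σ c
  eval ρ (t · u)   = eval ρ t ∙ eval ρ u

  Sat : ∀ {Γ} → All El Γ → Formula Γ → Set
  Sat ρ (t ≐ u)    = eval ρ t ≡ eval ρ u
  Sat ρ (t ∊ u)    = eval ρ t ∈ eval ρ u
  Sat ρ ⊥′         = ⊥
  Sat ρ (φ ∧ ψ)    = Sat ρ φ × Sat ρ ψ
  Sat ρ (φ ∨ ψ)    = Sat ρ φ ⊎ Sat ρ ψ
  Sat ρ (φ ⊃ ψ)    = Sat ρ φ → Sat ρ ψ
  Sat ρ (all′ σ φ) = (x : El σ) → Sat (x ∷ ρ) φ
  Sat ρ (ex′ σ φ)  = Σ[ x ∈ El σ ] Sat (x ∷ ρ) φ

standard : Structure
standard = record
  { El   = ⟦_⟧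
  ; name = λ _ c → c
  ; _∙_  = λ f x → f x
  ; _∈_  = λ x A → T (A x)
  }

-- El σ consists of the internal objects of type σ (for ι and ι ^ d, the
-- elements of *ℤ and *ℤᵈ) and name σ is the map a ↦ *a.

record NonstandardUniverse : Set₁ where
  field
    structure : Structure
  open Structure structure public
  field
    transfer   : (φ : Formula []) → Structure.Sat standard [] φ ⇔ Sat [] φ
    saturation : ∀ {σ} (A : ℕ → El (P σ)) →
                 (∀ n → ∃[ x ] (∀ k → k ℕ.≤ n → x ∈ A k)) →
                 ∃[ x ] (∀ k → x ∈ A k)

-- Extended real numbers as Dedekind cuts: x is represented by the set of
-- rationals strictly below it, so −∞ is ∅ and +∞ is ℚ.

record ℝ∞ : Set₁ where
  field
    Below : ℚ → Set
    down  : ∀ {p q} → p ℚ.< q → Below q → Below p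
    open′ : ∀ {q} → Below q → ∃[ r ] (q ℚ.< r × Below r)

open ℝ∞ using (Below)

infix 4 _≈ᴿ_ _<ᴿ_
infixl 6 _+ᴿ_

_≈ᴿ_ : ℝ∞ → ℝ∞ → Set
x ≈ᴿ y = ∀ q → Below x q ⇔ Below y q

_<ᴿ_ : ℝ∞ → ℝ∞ → Set
x <ᴿ y = ∃[ q ] (¬ Below x q × Below y q)

fromℚ : ℚ → ℝ∞
fromℚ q = record { Below = ℚ._< q ; down = ℚ.<-trans ; open′ = ℚ.<-dense }

0ᴿ 1ᴿ : ℝ∞
0ᴿ = fromℚ 0ℚ
1ᴿ = fromℚ 1ℚ

_+ᴿ_ : ℝ∞ → ℝ∞ → ℝ∞
x +ᴿ y = record
  { Below = λ q → ∃[ a ] ∃[ b ] (Below x a × Below y b × q ℚ.< a ℚ.+ b)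
  ; down  = λ { p<q (a , b , ax , by , q<) → a , b , ax , by , ℚ.<-trans p<q q< }
  ; open′ = λ { (a , b , ax , by , q<) →
                let (m , q<m , m<) = ℚ.<-dense q< in m , q<m , a , b , ax , by , m< }
  }

sup : {I : Set} → (I → ℝ∞) → ℝ∞
sup f = record
  { Below = λ q → ∃[ i ] Below (f i) q
  ; down  = λ { p<q (i , b) → i , ℝ∞.down (f i) p<q b }
  ; open′ = λ { (i , b) → let (r , q<r , b′) = ℝ∞.open′ (f i) b in r , q<r , i , b′ }
  }

-- The rational r is there because the plain intersection may have a maximum.

inf : {I : Set} → (I → ℝ∞) → ℝ∞
inf f = record
  { Below = λ q → ∃[ r ] (q ℚ.< r × (∀ i → Below (f i) r))
  ; down  = λ { p<q (r , q<r , b) → r , ℚ.<-trans p<q q<r , b }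
  ; open′ = λ { (r , q<r , b) →
                let (m , q<m , m<r) = ℚ.<-dense q<r in m , q<m , r , m<r , b }
  }

partialSum : (ℕ → ℝ∞) → ℕ → ℝ∞
partialSum f zero    = 0ᴿ
partialSum f (suc n) = partialSum f n +ᴿ f n

-- Only used for nonnegative terms.

series : (ℕ → ℝ∞) → ℝ∞
series f = sup (partialSum f)

-- The number of elements of a finite subset, and 0 for an infinite one.

card : ExcludedMiddle 0ℓ → {A : Set} → (A → Bool) → ℤ
card lem S with lem {∃[ n ] (Fin n ↔ ∃ (T ∘ S))}
... | yes (n , _) = + n
... | no _        = + 0

-- The set x + [-n,n]ᵈ in ℤᵈ.

box : ∀ {d} → Vec ℤ d → ℤ → Vec ℤ d → Bool
box x n y = ⌊ Pointwise.decidable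
                (λ a b → (a ℤ.- n ℤ.≤? b) ×-dec (b ℤ.≤? a ℤ.+ n)) x y ⌋

module Nonstandard (lem : ExcludedMiddle 0ℓ) (𝕌 : NonstandardUniverse) where

  open NonstandardUniverse 𝕌 public

  *ℤ : Set
  *ℤ = El ι

  *ℤ^_ : ℕ → Set
  *ℤ^ d = El (ι ^ d)

  Internal : ℕ → Set
  Internal d = El (P (ι ^ d))

  ⋆_ : ℤ → *ℤ
  ⋆ a = name ι a

  infix  30 ⋆_
  infix  4 _≤*_ _<*_
  infixl 6 _+*_ _⊕_
  infixl 7 _**_

  _+*_ _**_ : *ℤ → *ℤ → *ℤ
  a +* b = name (ι ⇒ ι ⇒ ι) ℤ._+_ ∙ a ∙ b
  a ** b = name (ι ⇒ ι ⇒ ι) ℤ._*_ ∙ a ∙ b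

  -*_ : *ℤ → *ℤ
  -* a = name (ι ⇒ ι) ℤ.-_ ∙ a

  _≤*_ _<*_ : *ℤ → *ℤ → Set
  a ≤* b = b ∈ name (ι ⇒ P ι) (λ m n → ⌊ m ℤ.≤? n ⌋) ∙ a
  a <* b = b ∈ name (ι ⇒ P ι) (λ m n → ⌊ m ℤ.<? n ⌋) ∙ a

  IsHypernatural : *ℤ → Set
  IsHypernatural a = ⋆ (+ 1) ≤* a

  IsInfiniteHypernatural : *ℤ → Set
  IsInfiniteHypernatural a = IsHypernatural a × (∀ (n : ℕ) → ¬ a ≡ ⋆ (+ n))

  coord : ∀ {d} → Fin d → *ℤ^ d → *ℤ
  coord {d} i x = name (ι ^ d ⇒ ι) (λ v → Vec.lookup v i) ∙ x

  _⊕_ : ∀ {d} → *ℤ^ d → *ℤ^ d → *ℤ^ d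
  _⊕_ {d} x y = name (ι ^ d ⇒ ι ^ d ⇒ ι ^ d) (Vec.zipWith ℤ._+_) ∙ x ∙ y

  origin : ∀ {d} → *ℤ^ d
  origin {d} = name (ι ^ d) (Vec.replicate d (+ 0))

  -- The internal set x + [-ν,ν]ᵈ in *ℤᵈ.

  *box : ∀ {d} → *ℤ^ d → *ℤ → Internal d
  *box {d} x ν = name (ι ^ d ⇒ ι ⇒ P (ι ^ d)) box ∙ x ∙ ν

  ∣_∣ : ∀ {d} → Internal d → *ℤ
  ∣_∣ {d} D = name (P (ι ^ d) ⇒ ι) (card lem) ∙ D

  ⟪_⟫ : ∀ {d} → Internal d → Pred (*ℤ^ d) 0ℓ
  ⟪ D ⟫ x = x ∈ D

  infix 4 _⊆*_

  _⊆*_ : ∀ {d} → Internal d → Internal d → Set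
  D ⊆* F = ∀ x → x ∈ D → x ∈ F

  -- st (a / b) for b > 0, as the supremum of the rationals r ≤ a / b; the
  -- inequality is multiplied out by the (positive) denominators.

  st[_/_] : *ℤ → *ℤ → ℝ∞
  st[ a / b ] = sup {Σ[ r ∈ ℚ ] (⋆ (↥ r) ** b ≤* a ** ⋆ (↧ r))} (fromℚ ∘ proj₁)

  -- The Loeb measure is the Carathéodory extension of D ↦ st (|D| / |F|) from
  -- the algebra of internal subsets of the nonempty hyperfinite set F.

  record Cover {d} (F : Internal d) (A : Pred (*ℤ^ d) 0ℓ) : Set where
    field
      set    : ℕ → Internal d
      inside : ∀ k → set k ⊆* F
      covers : ∀ x → (⟪ F ⟫ ∩ A) x → ∃[ k ] x ∈ set k

  -- As a function of arbitrary external A this is the outer measure; it is the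
  -- Loeb measure of A ∩ F whenever LoebMeasurable F A holds.

  μ : ∀ {d} → Internal d → Pred (*ℤ^ d) 0ℓ → ℝ∞
  μ F A = inf {Cover F A} λ c → series λ k → st[ ∣ Cover.set c k ∣ / ∣ F ∣ ]

  LoebMeasurable : ∀ {d} → Internal d → Pred (*ℤ^ d) 0ℓ → Set₁
  LoebMeasurable {d} F A =
    (B : Pred (*ℤ^ d) 0ℓ) → μ F B ≈ᴿ μ F (B ∩ A) +ᴿ μ F (B ∖ A)

  LoebNull : ∀ {d} → Internal d → Pred (*ℤ^ d) 0ℓ → Set₁
  LoebNull F A = LoebMeasurable F A × μ F A ≈ᴿ 0ᴿ

  record IsCut (H : *ℤ) (U : Pred *ℤ 0ℓ) : Set where
    field
      bounded  : ∀ {u} → U u → ⋆ (+ 1) ≤* u × u ≤* H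
      nonempty : ∃[ u ] U u
      initial  : ∀ {u v} → U u → ⋆ (+ 1) ≤* v → v ≤* u → U v
      closed   : ∀ {u v} → U u → U v → U (u +* v)

  _>ᶜ_ : *ℤ → Pred *ℤ 0ℓ → Set
  ν >ᶜ U = ∀ u → U u → u <* ν

  liminf : Pred *ℤ 0ℓ → (*ℤ → ℝ∞) → ℝ∞
  liminf U g =
    sup {Σ[ ξ ∈ *ℤ ] (IsHypernatural ξ × ξ >ᶜ U)} λ (ξ , _) →
    inf {Σ[ ν ∈ *ℤ ] (IsHypernatural ν × ν >ᶜ U × ν <* ξ)} λ (ν , _) → g ν

  𝒰 : Pred *ℤ 0ℓ → Pred *ℤ 0ℓ
  𝒰 U z = (∃[ u ] (U u × z ≡ -* u)) ⊎ z ≡ ⋆ (+ 0) ⊎ U z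

  _+𝒰[_] : ∀ {d} → Internal d → Pred *ℤ 0ℓ → Pred (*ℤ^ d) 0ℓ
  (E +𝒰[ U ]) x = ∃[ e ] ∃[ w ] (e ∈ E × (∀ i → 𝒰 U (coord i w)) × x ≡ e ⊕ w)

  density : ∀ {d} → Internal d → Pred *ℤ 0ℓ → *ℤ^ d → ℝ∞
  density E U x = liminf U λ ν → μ (*box x ν) ((E +𝒰[ U ]) ∩ ⟪ *box x ν ⟫)

{-# OPTIONS --safe #-}
module Submission where

-- Let B = E + [-u , u]ᵈ and C = E + [-v , v]ᵈ with u ∈ U < v.  The ratio
-- |E + [-n , n]ᵈ| / |[-H , H]ᵈ| is internal and finite, so overspill across U
-- makes |C ∖ B| / |[-H , H]ᵈ| as small as we please for suitable u and v,
-- whatever the cofinality of U.  Let ξ = v / 2, so that ξ > U.  If the density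
-- at x ∈ E + 𝒰ᵈ is below 1 − 1/m, some box x + [-ν , ν]ᵈ with U < ν < ξ meets
-- E + 𝒰ᵈ, and hence its internal subset B, in at most that proportion; as the
-- box lies inside C, at least 1/m of it lies in C ∖ B.  By the Vitali covering
-- argument the centres of such boxes number at most 2ᵈ m |C ∖ B|.

open import Defs
open import Algebra.Properties.AbelianGroup using (∙-cancelˡ)
open import Axiom.ExcludedMiddle using (ExcludedMiddle)
open import Axiom.Extensionality.Propositional using (Extensionality)
open import Data.Bool.Base using (Bool; true; false; T; not) renaming (_∧_ to _&&_; _∨_ to _||_)
open import Data.Bool.Properties using (T?; T-∧; T-∨; T-irrelevant)
open import Data.Empty using (⊥; ⊥-elim)
open import Data.Fin.Base using (Fin; zero; suc)
open import Data.Fin.Permutation using (↔⇒≡)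
open import Data.Fin.Properties using (injective⇒≤)
open import Data.Integer.Base as ℤ using (ℤ; +_; -[1+_])
import Data.Integer.Properties as ℤ
import Data.Integer.Tactic.RingSolver as ℤ-Solver
open import Data.List.Base as List using (List; []; _∷_; length; filter; applyUpTo; cartesianProductWith)
open import Data.List.Extrema.Nat using (argmax; f[xs]≤f[argmax]; f[⊥]≤f[argmax]; argmax-sel)
open import Data.List.Membership.Propositional using (lose) renaming (_∈_ to _∈ˡ_)
open import Data.List.Membership.Propositional.Properties
  using (∈-lookup; ∈-filter⁺; ∈-filter⁻; ∈-applyUpTo⁺; ∈-applyUpTo⁻; ∈-cartesianProductWith⁺; ∈-cartesianProductWith⁻)
open import Data.List.Properties using (length-applyUpTo; length-map; length-++; filter-notAll)
open import Data.List.Relation.Unary.All as All using (All; []; _∷_)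
open import Data.List.Relation.Unary.AllPairs using ([]; _∷_)
open import Data.List.Relation.Unary.Any using (here; there; index)
open import Data.List.Relation.Unary.Any.Properties using (lookup-index)
open import Data.List.Relation.Unary.Unique.Propositional using (Unique)
open import Data.List.Relation.Unary.Unique.Propositional.Properties
  using (filter⁺; applyUpTo⁺₁; cartesianProductWith⁺)
open import Data.Nat.Base as ℕ using (ℕ; zero; suc; _≤_; _<_; z≤n; s≤s)
open import Data.Nat.Divisibility using (_∣_; ∣m+n∣m⇒∣n; ∣1⇒≡1)
import Data.Nat.Properties as ℕ
import Data.Nat.Tactic.RingSolver as ℕ-Solver
open import Data.Product using (∃; ∃-syntax; _×_; _,_; proj₁; proj₂)
open import Data.Rational.Base as ℚ using (ℚ; mkℚ; ↥_; ↧_; 0ℚ; 1ℚ)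
import Data.Rational.Properties as ℚ
open import Data.Rational.Solver using (module +-*-Solver)
import Data.Rational.Unnormalised.Base as ℚᵘ
import Data.Rational.Unnormalised.Properties as ℚᵘ
open import Data.Sum.Base as Sum using (_⊎_; inj₁; inj₂; [_,_]′)
open import Data.Vec.Base as Vec using (Vec; []; _∷_)
import Data.Vec.Properties as Vec
open import Data.Vec.Relation.Binary.Pointwise.Inductive as Pointwise using (Pointwise; []; _∷_)
open import Function.Base using (_∘_; id)
open import Function.Bundles using (_↔_; mk⇔; mk↔ₛ′; Equivalence)
open import Function.Properties.Inverse using (↔-sym; ↔-trans)
open import Level using (0ℓ)
open import Relation.Binary.PropositionalEquality using (_≡_; refl; sym; trans; cong; cong₂; subst; subst₂)
open import Relation.Nullary using (¬_; Dec; yes; no)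
open import Relation.Nullary.Decidable using (⌊_⌋; toWitness; fromWitness; decidable-stable)
open import Relation.Nullary.Negation using (contradiction)
open import Relation.Unary using (Pred; _∩_; _∖_)

open ℝ∞ using (Below; down)

-- A point has density below 1 when its density is at most some rational `q < level k`, where
-- `level k = 1 − 1/m` with `m = k + 1`. The exceptional set is thus a countable union, and it is
-- enough to put the part belonging to each `k` inside a single internal set of measure at most any
-- prescribed ε. The obstacle is that E + 𝒰ᵈ is external and that the radius ν depends on `x`. Both
-- `u` and `v` are therefore fixed from `k` and ε before any `x` is considered. The centres to be
-- covered then lie in one internal set, `bad*`, to which a counting bound transfers. Passing from E
-- + 𝒰ᵈ to B loses nothing: only a lower bound for the outer measure inside a box is used, and
-- internal subsets supply it. All counting takes place in ℤᵈ, for arbitrary sets and radii; cuts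
-- and saturation enter after transfer. The constant is `N = 2ᵈ m b`, with `b` the denominator of ε:
-- `N |C ∖ B| < |[-H , H]ᵈ|` absorbs both the covering factor `2ᵈ m` and the passage to ε.

private
  variable
    A : Set
    d : ℕ

-- Boolean-valued subsets.

infix 4 _⊑_

_⊑_ : (A → Bool) → (A → Bool) → Set
S ⊑ R = ∀ x → T (S x) → T (R x)

infixr 7 _⊓_
infixr 6 _⊔_

_⊓_ _⊔_ _─_ : (A → Bool) → (A → Bool) → A → Bool
(S ⊓ R) x = S x && R x
(S ⊔ R) x = S x || R x
(S ─ R) x = S x && not (R x)

T-not⁺ : ∀ {b} → ¬ T b → T (not b)
T-not⁺ {true}  ¬t = ¬t _
T-not⁺ {false} ¬t = _

T-not⁻ : ∀ {b} → T (not b) → ¬ T b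
T-not⁻ {true} ()

module _ {S R : A → Bool} {x : A} where

  ⊓⁺ : T (S x) → T (R x) → T ((S ⊓ R) x)
  ⊓⁺ s r = Equivalence.from T-∧ (s , r)

  ⊓⁻ : T ((S ⊓ R) x) → T (S x) × T (R x)
  ⊓⁻ = Equivalence.to T-∧

  ─⁺ : T (S x) → ¬ T (R x) → T ((S ─ R) x)
  ─⁺ s r = Equivalence.from T-∧ (s , T-not⁺ r)

  ─⁻ : T ((S ─ R) x) → T (S x) × ¬ T (R x)
  ─⁻ t = let (s , r) = Equivalence.to T-∧ t in s , T-not⁻ r

-- Counting

count : (A → Bool) → List A → ℕ
count S L = length (filter (T? ∘ S) L)

count-mono : {S R : A → Bool} → S ⊑ R → ∀ L → count S L ≤ count R L
count-mono S⊑R [] = z≤n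
count-mono {S = S} {R} S⊑R (x ∷ L) with S x | R x | S⊑R x
... | true  | true  | _ = s≤s (count-mono S⊑R L)
... | true  | false | f = ⊥-elim (f _)
... | false | true  | _ = ℕ.m≤n⇒m≤1+n (count-mono S⊑R L)
... | false | false | _ = count-mono S⊑R L

count-split : (S R : A → Bool) → ∀ L → count S L ≡ count (S ⊓ R) L ℕ.+ count (S ─ R) L
count-split S R [] = refl
count-split S R (x ∷ L) with S x | R x
... | true  | true  = cong suc (count-split S R L)
... | true  | false = trans (cong suc (count-split S R L)) (sym (ℕ.+-suc _ _))
... | false | _     = count-split S R L

count-⊔ : (S R : A → Bool) → ∀ L → count (S ⊔ R) L ≤ count S L ℕ.+ count R L
count-⊔ S R [] = z≤n
count-⊔ S R (x ∷ L) with S x | R x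
... | true  | true  = s≤s (ℕ.≤-trans (count-⊔ S R L) (ℕ.+-monoʳ-≤ _ (ℕ.n≤1+n _)))
... | true  | false = s≤s (count-⊔ S R L)
... | false | true  = ℕ.≤-trans (s≤s (count-⊔ S R L)) (ℕ.≤-reflexive (sym (ℕ.+-suc _ _)))
... | false | false = count-⊔ S R L

lookup-injective : {xs : List A} → Unique xs → ∀ {i j} → List.lookup xs i ≡ List.lookup xs j → i ≡ j
lookup-injective (_ ∷ _) {zero} {zero} _ = refl
lookup-injective (x∉ ∷ _) {zero} {suc j} eq = contradiction eq (All.lookup x∉ (∈-lookup j))
lookup-injective (x∉ ∷ _) {suc i} {zero} eq = contradiction (sym eq) (All.lookup x∉ (∈-lookup i))
lookup-injective (_ ∷ u) {suc i} {suc j} eq = cong suc (lookup-injective u eq)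

Unique⇒length-≤ : {xs ys : List A} → Unique xs → (∀ {x} → x ∈ˡ xs → x ∈ˡ ys) → length xs ≤ length ys
Unique⇒length-≤ {xs = xs} {ys} u xs⊆ys = injective⇒≤ {f = f} λ {i} {j} eq →
  lookup-injective u (trans (lookup-index (f′ i)) (trans (cong (List.lookup ys) eq) (sym (lookup-index (f′ j)))))
  where
  f′ = λ i → xs⊆ys (∈-lookup {xs = xs} i)
  f = λ i → index (f′ i)

module _ {S : A → Bool} {L : List A} (u : Unique L) (S⊆L : ∀ x → T (S x) → x ∈ˡ L) where

  private
    M = filter (T? ∘ S) L
    elem : ∀ x → T (S x) → x ∈ˡ M
    elem x s = ∈-filter⁺ (T? ∘ S) (S⊆L x s) s

  Fin-count↔ : Fin (count S L) ↔ ∃ (T ∘ S)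
  Fin-count↔ = mk↔ₛ′
    (λ i → List.lookup M i , proj₂ (∈-filter⁻ (T? ∘ S) {xs = L} (∈-lookup i)))
    (λ (x , s) → index (elem x s))
    (λ (x , s) → Σ-≡ (sym (lookup-index (elem x s))))
    (λ i → lookup-injective (filter⁺ (T? ∘ S) u) (sym (lookup-index (elem (List.lookup M i) _))))
    where
    Σ-≡ : {p q : ∃ (T ∘ S)} → proj₁ p ≡ proj₁ q → p ≡ q
    Σ-≡ {x , s} {_ , t} refl = cong (x ,_) (T-irrelevant s t)

  -- `card` obtains its bijection from excluded middle, so its value is known only by comparison
  -- with an explicit enumeration; a bijection between `Fin n` and `Fin n′` forces `n ≡ n′`.
  card-count : (lem : ExcludedMiddle 0ℓ) → card lem S ≡ + count S L
  card-count lem with lem {∃[ n ] (Fin n ↔ ∃ (T ∘ S))}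
  ... | yes (n , e) = cong +_ (↔⇒≡ (↔-trans e (↔-sym Fin-count↔)))
  ... | no ¬finite  = contradiction (_ , Fin-count↔) ¬finite

-- Boxes

-- Reduces a linear inequality to a ring identity: the slack is exhibited as a nonnegative term, and
-- the solver checks that it equals `y − x`.
≤-by : ∀ {t x y} → ℤ.0ℤ ℤ.≤ t → t ≡ y ℤ.- x → x ℤ.≤ y
≤-by 0≤t refl = ℤ.0≤i-j⇒j≤i 0≤t

0≤-+ : ∀ {a b} → ℤ.0ℤ ℤ.≤ a → ℤ.0ℤ ℤ.≤ b → ℤ.0ℤ ℤ.≤ a ℤ.+ b
0≤-+ = ℤ.+-mono-≤

≤-by₂ : ∀ {a b c e x y} → a ℤ.≤ b → c ℤ.≤ e → (b ℤ.- a) ℤ.+ (e ℤ.- c) ≡ y ℤ.- x → x ℤ.≤ y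
≤-by₂ a≤b c≤e = ≤-by (0≤-+ (ℤ.i≤j⇒0≤j-i a≤b) (ℤ.i≤j⇒0≤j-i c≤e))

-- Spelled exactly as the relation decided inside `box`, so that `box⁻` and `box⁺` merely extract
-- and insert witnesses.
Near : ℤ → Vec ℤ d → Vec ℤ d → Set
Near n = Pointwise λ a b → a ℤ.- n ℤ.≤ b × b ℤ.≤ a ℤ.+ n

box⁻ : ∀ {n} {x y : Vec ℤ d} → T (box x n y) → Near n x y
box⁻ = toWitness

box⁺ : ∀ {n} {x y : Vec ℤ d} → Near n x y → T (box x n y)
box⁺ = fromWitness

Near-refl : ∀ {n} → ℤ.0ℤ ℤ.≤ n → {x : Vec ℤ d} → Near n x x
Near-refl 0≤n = Pointwise.refl λ {a} → ≤-by 0≤n (eq₁ a _) , ≤-by 0≤n (eq₂ a _)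
  where
  eq₁ : ∀ a n → n ≡ a ℤ.- (a ℤ.- n)
  eq₁ = ℤ-Solver.solve-∀
  eq₂ : ∀ a n → n ≡ (a ℤ.+ n) ℤ.- a
  eq₂ = ℤ-Solver.solve-∀

Near-sym : ∀ {n} {x y : Vec ℤ d} → Near n x y → Near n y x
Near-sym [] = []
Near-sym {n = n} (_∷_ {x = a} {y = b} (p , q) r) =
  (≤-by (ℤ.i≤j⇒0≤j-i q) (eq₁ a b n) , ≤-by (ℤ.i≤j⇒0≤j-i p) (eq₂ a b n)) ∷ Near-sym r
  where
  eq₁ : ∀ a b n → (a ℤ.+ n) ℤ.- b ≡ a ℤ.- (b ℤ.- n)
  eq₁ = ℤ-Solver.solve-∀
  eq₂ : ∀ a b n → b ℤ.- (a ℤ.- n) ≡ (b ℤ.+ n) ℤ.- a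
  eq₂ = ℤ-Solver.solve-∀

Near-trans : ∀ {m n} {x y z : Vec ℤ d} → Near m x y → Near n y z → Near (m ℤ.+ n) x z
Near-trans [] [] = []
Near-trans {m = m} {n} (_∷_ {x = a} {y = b} (p , q) r) (_∷_ {y = c} (p′ , q′) r′) =
  (≤-by₂ p p′ (eq₁ a b c m n) , ≤-by₂ q q′ (eq₂ a b c m n)) ∷ Near-trans r r′
  where
  eq₁ : ∀ a b c m n → (b ℤ.- (a ℤ.- m)) ℤ.+ (c ℤ.- (b ℤ.- n)) ≡ c ℤ.- (a ℤ.- (m ℤ.+ n))
  eq₁ = ℤ-Solver.solve-∀
  eq₂ : ∀ a b c m n → ((a ℤ.+ m) ℤ.- b) ℤ.+ ((b ℤ.+ n) ℤ.- c) ≡ (a ℤ.+ (m ℤ.+ n)) ℤ.- c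
  eq₂ = ℤ-Solver.solve-∀

Near-mono : ∀ {m n} → m ℤ.≤ n → {x y : Vec ℤ d} → Near m x y → Near n x y
Near-mono m≤n = Pointwise.map λ {a} (p , q) →
  ℤ.≤-trans (ℤ.+-monoʳ-≤ a (ℤ.neg-mono-≤ m≤n)) p , ℤ.≤-trans q (ℤ.+-monoʳ-≤ a m≤n)

interval : ℤ → ℕ → List ℤ
interval a n = applyUpTo (λ i → (a ℤ.- + n) ℤ.+ + i) (suc (n ℕ.+ n))

boxList : Vec ℤ d → ℕ → List (Vec ℤ d)
boxList []      n = [] ∷ []
boxList (a ∷ x) n = cartesianProductWith _∷_ (interval a n) (boxList x n)

boxList-unique : ∀ (x : Vec ℤ d) n → Unique (boxList x n)
boxList-unique []      n = [] ∷ []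
boxList-unique (a ∷ x) n = cartesianProductWith⁺ _∷_ Vec.∷-injective
  (applyUpTo⁺₁ _ (suc (n ℕ.+ n)) λ i<j _ eq → ℕ.<⇒≢ i<j (ℤ.+-injective
      (∙-cancelˡ ℤ.+-0-abelianGroup (a ℤ.- + n) _ _ eq)))
  (boxList-unique x n)

vol : ℕ → ℕ → ℕ
vol d n = suc (n ℕ.+ n) ℕ.^ d

length-cartesianProductWith : ∀ {A B C : Set} (f : A → B → C) xs ys →
  length (cartesianProductWith f xs ys) ≡ length xs ℕ.* length ys
length-cartesianProductWith f []       ys = refl
length-cartesianProductWith f (x ∷ xs) ys =
  trans (length-++ (List.map (f x) ys)) (cong₂ ℕ._+_ (length-map (f x) ys) (length-cartesianProductWith f xs ys))

length-boxList : ∀ (x : Vec ℤ d) n → length (boxList x n) ≡ vol d n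
length-boxList []      n = refl
length-boxList (a ∷ x) n =
  trans (length-cartesianProductWith _∷_ (interval a n) (boxList x n))
    (cong₂ ℕ._*_ (length-applyUpTo (λ i → (a ℤ.- + n) ℤ.+ + i) (suc (n ℕ.+ n))) (length-boxList x n))

∈-interval : ∀ {a b n} → a ℤ.- + n ℤ.≤ b → b ℤ.≤ a ℤ.+ + n → b ∈ˡ interval a n
∈-interval {a} {b} {n} p q =
  subst (_∈ˡ interval a n) (trans (cong (λ k → (a ℤ.- + n) ℤ.+ k) i≡) (eq₁ (a ℤ.- + n) b))
    (∈-applyUpTo⁺ (λ i → (a ℤ.- + n) ℤ.+ + i) (s≤s (ℤ.drop‿+≤+
        (subst (ℤ._≤ + (n ℕ.+ n)) (sym i≡) (≤-by (ℤ.i≤j⇒0≤j-i q) (eq₂ a b (+ n)))))))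
  where
  i≡ : + ℤ.∣ b ℤ.- (a ℤ.- + n) ∣ ≡ b ℤ.- (a ℤ.- + n)
  i≡ = ℤ.0≤i⇒+∣i∣≡i (ℤ.i≤j⇒0≤j-i p)
  eq₁ : ∀ c b → c ℤ.+ (b ℤ.- c) ≡ b
  eq₁ = ℤ-Solver.solve-∀
  eq₂ : ∀ a b n → (a ℤ.+ n) ℤ.- b ≡ (n ℤ.+ n) ℤ.- (b ℤ.- (a ℤ.- n))
  eq₂ = ℤ-Solver.solve-∀

∈-boxList⁺ : ∀ {x y : Vec ℤ d} {n} → Near (+ n) x y → y ∈ˡ boxList x n
∈-boxList⁺ [] = here refl
∈-boxList⁺ (_∷_ {x = a} (p , q) r) = ∈-cartesianProductWith⁺ _∷_ (∈-interval {a} p q) (∈-boxList⁺ r)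

∈-boxList⁻ : ∀ (x : Vec ℤ d) {y} n → y ∈ˡ boxList x n → Near (+ n) x y
∈-boxList⁻ []      n (here refl) = []
∈-boxList⁻ (a ∷ x) n y∈ with ∈-cartesianProductWith⁻ _∷_ (interval a n) (boxList x n) y∈
... | b , z , b∈ , z∈ , refl with ∈-applyUpTo⁻ (λ i → (a ℤ.- + n) ℤ.+ + i) b∈
...   | i , s≤s i≤ , refl =
  ( ≤-by (ℤ.+≤+ (z≤n {i})) (eq₁ (a ℤ.- + n) (+ i))
  , ≤-by (ℤ.i≤j⇒0≤j-i (ℤ.+≤+ i≤)) (eq₂ a (+ n) (+ i)) ) ∷ ∈-boxList⁻ x n z∈
  where
  eq₁ : ∀ a n → n ≡ (a ℤ.+ n) ℤ.- a
  eq₁ = ℤ-Solver.solve-∀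
  eq₂ : ∀ a n i → (n ℤ.+ n) ℤ.- i ≡ (a ℤ.+ n) ℤ.- ((a ℤ.- n) ℤ.+ i)
  eq₂ = ℤ-Solver.solve-∀

^-distribʳ-* : ∀ k m n → (m ℕ.* n) ℕ.^ k ≡ m ℕ.^ k ℕ.* n ℕ.^ k
^-distribʳ-* zero    m n = refl
^-distribʳ-* (suc k) m n = trans (cong (m ℕ.* n ℕ.*_) (^-distribʳ-* k m n)) (eq m n _ _)
  where
  eq : ∀ m n p q → m ℕ.* n ℕ.* (p ℕ.* q) ≡ m ℕ.* p ℕ.* (n ℕ.* q)
  eq = ℕ-Solver.solve-∀

-- In each coordinate `4n + 1 ≤ 2 (2n + 1)`. The covering argument counts centres rather than the
-- points of their boxes, so doubling replaces the usual tripling and the factor is 2ᵈ instead of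
-- 3ᵈ.
vol-double : ∀ d n → vol d (n ℕ.+ n) ≤ 2 ℕ.^ d ℕ.* vol d n
vol-double d n = ℕ.≤-trans
  (ℕ.^-monoˡ-≤ d (ℕ.≤-trans (ℕ.n≤1+n _) (ℕ.≤-reflexive (eq n))))
  (ℕ.≤-reflexive (^-distribʳ-* d 2 (suc (n ℕ.+ n))))
  where
  eq : ∀ n → suc (suc ((n ℕ.+ n) ℕ.+ (n ℕ.+ n))) ≡ 2 ℕ.* suc (n ℕ.+ n)
  eq = ℕ-Solver.solve-∀

count-box : ∀ {L : List (Vec ℤ d)} → Unique L → ∀ x n → count (box x (+ n)) L ≤ vol d n
count-box {L = L} u x n = ℕ.≤-trans
  (Unique⇒length-≤ (filter⁺ (T? ∘ box x (+ n)) u)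
    λ y∈ → ∈-boxList⁺ (box⁻ (proj₂ (∈-filter⁻ (T? ∘ box x (+ n)) {xs = L} y∈))))
  (ℕ.≤-reflexive (length-boxList x n))

module _ (lem : ExcludedMiddle 0ℓ) where

  card-in-box : ∀ {S : Vec ℤ d → Bool} {x n} → S ⊑ box x (+ n) → card lem S ≡ + count S (boxList x n)
  card-in-box {x = x} {n} S⊑ = card-count (boxList-unique x n) (λ y s → ∈-boxList⁺ (box⁻ (S⊑ y s))) lem

  card-box : ∀ (x : Vec ℤ d) n → card lem (box x (+ n)) ≡ + vol d n
  card-box {d = d} x n = trans (card-in-box {S = box x (+ n)} {x = x} {n} λ _ → id)
    (cong +_ (ℕ.≤-antisym (count-box (boxList-unique x n) x n)
      (subst (_≤ count (box x (+ n)) (boxList x n)) (length-boxList x n)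
        (Unique⇒length-≤ (boxList-unique x n) λ y∈ → ∈-filter⁺ (T? ∘ box x (+ n)) y∈ (box⁺ (∈-boxList⁻ x n y∈))))))

-- Vitali covering

module _ (m : ℕ) (L : List (Vec ℤ d)) (ρ : Vec ℤ d → ℕ) where

  -- Greedy selection: the box of largest radius ρ x is chosen, all centres in
  -- its double are discarded (they number at most 2ᵈ times the size of the
  -- box), and the box is removed from S.
  vitali : ∀ n (S : Vec ℤ d → Bool) Y → length Y ≤ n → Unique Y →
           (∀ {y} → y ∈ˡ Y → vol d (ρ y) ≤ m ℕ.* count (box y (+ ρ y) ⊓ S) L) →
           length Y ≤ 2 ℕ.^ d ℕ.* (m ℕ.* count S L)
  vitali n S [] _ _ _ = z≤n
  vitali (suc n) S Y@(y₀ ∷ Y₀) (s≤s len) u dense = bound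
    where
    x = argmax ρ y₀ Y₀
    x∈Y : x ∈ˡ Y
    x∈Y with argmax-sel ρ y₀ Y₀
    ... | inj₁ eq = here eq
    ... | inj₂ x∈ = there x∈
    ρ-max : ∀ {y} → y ∈ˡ Y → ρ y ≤ ρ x
    ρ-max = All.lookup (f[⊥]≤f[argmax] {f = ρ} y₀ Y₀ ∷ f[xs]≤f[argmax] {f = ρ} y₀ Y₀)

    B₁ B₂ : Vec ℤ d → Bool
    B₁ = box x (+ ρ x)
    B₂ = box x (+ (ρ x ℕ.+ ρ x))
    Y′ = filter (T? ∘ (not ∘ B₂)) Y
    S′ = S ─ B₁

    Y′-dense : ∀ {y} → y ∈ˡ Y′ → vol d (ρ y) ≤ m ℕ.* count (box y (+ ρ y) ⊓ S′) L
    Y′-dense {y} y∈ with ∈-filter⁻ (T? ∘ (not ∘ B₂)) {xs = Y} y∈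
    ... | y∈Y , far = ℕ.≤-trans (dense y∈Y) (ℕ.*-monoʳ-≤ m (count-mono disjoint L))
      where
      -- A common point of the boxes at `x` and `y` would put `y` within `ρ x + ρ y ≤ 2 ρ x` of `x`,
      -- hence in `B₂`. Removing `B₁` from `S` therefore takes nothing from the box of a surviving
      -- centre.
      disjoint : (box y (+ ρ y) ⊓ S) ⊑ (box y (+ ρ y) ⊓ S′)
      disjoint z t = let (b , s) = ⊓⁻ {S = box y (+ ρ y)} {S} t in
        ⊓⁺ {S = box y (+ ρ y)} {S′} b (─⁺ {S = S} {B₁} s λ b₁ → T-not⁻ far
          (box⁺ (Near-mono (ℤ.+≤+ (ℕ.+-monoʳ-≤ (ρ x) (ρ-max y∈Y))) (Near-trans (box⁻ b₁) (Near-sym (box⁻ b))))))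

    Y′-short : length Y′ ≤ n
    -- The centre `x` lies in its own double and is discarded, so the length bound driving the
    -- recursion drops.
    Y′-short = ℕ.≤-pred (ℕ.≤-trans
      (filter-notAll (T? ∘ (not ∘ B₂)) Y (lose x∈Y λ far → T-not⁻ far (box⁺ (Near-refl (ℤ.+≤+ z≤n)))))
      (s≤s len))

    Y-split : length Y ≡ count B₂ Y ℕ.+ length Y′
    Y-split = trans (cong length (sym (count-all Y))) (count-split (λ _ → true) B₂ Y)
      where
      count-all : ∀ Z → filter (T? ∘ (λ (_ : Vec ℤ d) → true)) Z ≡ Z
      count-all []      = refl
      count-all (z ∷ Z) = cong (z ∷_) (count-all Z)

    bound : length Y ≤ 2 ℕ.^ d ℕ.* (m ℕ.* count S L)
    bound = begin
      length Y
        ≡⟨ Y-split ⟩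
      count B₂ Y ℕ.+ length Y′
        -- `Y` has no repetitions, so the discarded centres are no more numerous than the lattice
        -- points of the doubled box.
        ≤⟨ ℕ.+-mono-≤ (count-box u x (ρ x ℕ.+ ρ x)) (vitali n S′ Y′ Y′-short
            (filter⁺ (T? ∘ (not ∘ B₂)) u) Y′-dense) ⟩
      vol d (ρ x ℕ.+ ρ x) ℕ.+ 2 ℕ.^ d ℕ.* (m ℕ.* count S′ L)
        ≤⟨ ℕ.+-monoˡ-≤ _ (vol-double d (ρ x)) ⟩
      2 ℕ.^ d ℕ.* vol d (ρ x) ℕ.+ 2 ℕ.^ d ℕ.* (m ℕ.* count S′ L)
        ≤⟨ ℕ.+-monoˡ-≤ _ (ℕ.*-monoʳ-≤ (2 ℕ.^ d) (dense x∈Y)) ⟩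
      2 ℕ.^ d ℕ.* (m ℕ.* count (B₁ ⊓ S) L) ℕ.+ 2 ℕ.^ d ℕ.* (m ℕ.* count S′ L)
        ≤⟨ ℕ.+-monoˡ-≤ _ (ℕ.*-monoʳ-≤ (2 ℕ.^ d) (ℕ.*-monoʳ-≤ m (count-mono swap L))) ⟩
      2 ℕ.^ d ℕ.* (m ℕ.* count (S ⊓ B₁) L) ℕ.+ 2 ℕ.^ d ℕ.* (m ℕ.* count S′ L)
        ≡⟨ eq (2 ℕ.^ d) m _ _ ⟩
      2 ℕ.^ d ℕ.* (m ℕ.* (count (S ⊓ B₁) L ℕ.+ count S′ L))
        ≡⟨ cong (λ c → 2 ℕ.^ d ℕ.* (m ℕ.* c)) (sym (count-split S B₁ L)) ⟩
      2 ℕ.^ d ℕ.* (m ℕ.* count S L) ∎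
      where
      open ℕ.≤-Reasoning
      swap : (B₁ ⊓ S) ⊑ (S ⊓ B₁)
      swap z t = let (b , s) = ⊓⁻ {S = B₁} {S} t in ⊓⁺ {S = S} {B₁} s b
      eq : ∀ p m a b → p ℕ.* (m ℕ.* a) ℕ.+ p ℕ.* (m ℕ.* b) ≡ p ℕ.* (m ℕ.* (a ℕ.+ b))
      eq = ℕ-Solver.solve-∀

-- Rational arithmetic

-- The normal form of `r − s` may have lost a common factor. The inequality is linear for the
-- unreduced fraction `(nE − kD) / DE`; `cross` carries it over to the reduced one.
sub-ratio : ∀ r s {x a b c} →
            ↥ r ℤ.* c ℤ.≤ x ℤ.* ↧ r → x ℤ.≤ a ℤ.+ b → a ℤ.* ↧ s ℤ.≤ ↥ s ℤ.* c →
            ↥ (r ℚ.- s) ℤ.* c ℤ.≤ b ℤ.* ↧ (r ℚ.- s)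
sub-ratio r@(mkℚ n d-1 _) s@(mkℚ k e-1 _) {x} {a} {b} {c} rc≤x x≤a+b a≤sc =
  ℤ.*-cancelʳ-≤-pos _ _ (D ℤ.* E)
    (subst₂ ℤ._≤_ (trans (eq₃ M c (n ℤ.* E ℤ.+ ℤ.- k ℤ.* D))
        (trans (cong (ℤ._* c) (sym cross)) (eq₄ N (D ℤ.* E) c))) (eq₅ b (D ℤ.* E) M)
      (ℤ.*-monoʳ-≤-nonNeg M unnormalised))
  where
  D = + suc d-1
  E = + suc e-1
  N = ↥ (r ℚ.- s)
  M = ↧ (r ℚ.- s)

  cross : N ℤ.* (D ℤ.* E) ≡ (n ℤ.* E ℤ.+ ℤ.- k ℤ.* D) ℤ.* M
  cross = subst₂ (λ p q → p ℤ.* (D ℤ.* E) ≡ (n ℤ.* E ℤ.+ ℤ.- k ℤ.* D) ℤ.* q)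
    (ℚ.↥ᵘ-toℚᵘ (r ℚ.- s)) (ℚ.↧ᵘ-toℚᵘ (r ℚ.- s)) (ℚᵘ.drop-*≡*
        (ℚᵘ.≃-trans (ℚ.toℚᵘ-homo-+ r (ℚ.- s)) (ℚᵘ.+-congʳ (ℚ.toℚᵘ r) (ℚ.toℚᵘ-homo‿- s))))

  eq₁ : ∀ n k a b c x D E → (x ℤ.* D ℤ.- n ℤ.* c) ℤ.* E ℤ.+
      ((k ℤ.* c ℤ.- a ℤ.* E) ℤ.* D ℤ.+ ((a ℤ.+ b) ℤ.- x) ℤ.* (D ℤ.* E))
        ≡ b ℤ.* (D ℤ.* E) ℤ.- (n ℤ.* E ℤ.+ ℤ.- k ℤ.* D) ℤ.* c
  eq₁ = ℤ-Solver.solve-∀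
  eq₃ : ∀ M c p → p ℤ.* c ℤ.* M ≡ p ℤ.* M ℤ.* c
  eq₃ = ℤ-Solver.solve-∀
  eq₄ : ∀ N d c → N ℤ.* d ℤ.* c ≡ N ℤ.* c ℤ.* d
  eq₄ = ℤ-Solver.solve-∀
  eq₅ : ∀ b d M → b ℤ.* d ℤ.* M ≡ b ℤ.* M ℤ.* d
  eq₅ = ℤ-Solver.solve-∀

  unnormalised : (n ℤ.* E ℤ.+ ℤ.- k ℤ.* D) ℤ.* c ℤ.≤ b ℤ.* (D ℤ.* E)
  unnormalised = ≤-by
    (0≤-+ (ℤ.*-monoʳ-≤-nonNeg E (ℤ.i≤j⇒0≤j-i rc≤x))
      (0≤-+ (ℤ.*-monoʳ-≤-nonNeg D (ℤ.i≤j⇒0≤j-i a≤sc)) (ℤ.*-monoʳ-≤-nonNeg (D ℤ.* E) (ℤ.i≤j⇒0≤j-i x≤a+b))))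
    (eq₁ n k a b c x D E)

ratio≤1 : ∀ {r a c} → + 1 ℤ.≤ c → a ℤ.≤ c → ↥ r ℤ.* c ℤ.≤ a ℤ.* ↧ r → r ℚ.≤ 1ℚ
ratio≤1 {r@record{}} {a} {+ suc c} _ a≤c rc≤a = ℚ.*≤* (ℤ.*-cancelʳ-≤-pos _ _ (+ suc c)
  (subst₂ ℤ._≤_ (cong (ℤ._* + suc c) (sym (ℤ.*-identityʳ (↥ r))))
      (trans (ℤ.*-comm (+ suc c) (↧ r)) (cong (ℤ._* + suc c) (sym (ℤ.*-identityˡ (↧ r)))))
    (ℤ.≤-trans rc≤a (ℤ.*-monoʳ-≤-nonNeg (↧ r) a≤c))))
ratio≤1 {c = + zero} (ℤ.+≤+ ())

ratio≤0 : ∀ {r c} → + 1 ℤ.≤ c → ↥ r ℤ.* c ℤ.≤ + 0 ℤ.* ↧ r → r ℚ.≤ 0ℚ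
ratio≤0 {r@record{}} {+ suc c} _ rc≤0 = ℚ.*≤* (ℤ.*-cancelʳ-≤-pos _ _ (+ suc c)
  (subst (ℤ._≤ + 0) (cong (ℤ._* + suc c) (sym (ℤ.*-identityʳ (↥ r)))) rc≤0))
ratio≤0 {c = + zero} (ℤ.+≤+ ())

-- A grid of mesh `δ` on which `st-+` locates a hyperrational. By recursion on `k`, consecutive grid
-- points differ by `δ` definitionally.
multiples : ℚ → ℕ → ℚ
multiples δ zero    = 0ℚ
multiples δ (suc k) = multiples δ k ℚ.+ δ

multiples-≃ : ∀ δ k → ℚ.toℚᵘ (multiples δ k) ℚᵘ.≃ ℚᵘ.mkℚᵘ (+ k ℤ.* ↥ δ) (ℚ.denominator-1 δ)
multiples-≃ δ          zero    = ℚᵘ.*≡* refl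
multiples-≃ δ@record{} (suc k) =
  ℚᵘ.≃-trans (ℚ.toℚᵘ-homo-+ (multiples δ k) δ)
    (ℚᵘ.≃-trans (ℚᵘ.+-congˡ (ℚ.toℚᵘ δ) (multiples-≃ δ k)) (ℚᵘ.*≡* (eq (+ k) (↥ δ) (↧ δ))))
  where
  eq : ∀ k n b → (k ℤ.* n ℤ.* b ℤ.+ n ℤ.* b) ℤ.* b ≡ ((+ 1 ℤ.+ k) ℤ.* n) ℤ.* (b ℤ.* b)
  eq = ℤ-Solver.solve-∀

archimedean : ∀ {δ} → 0ℚ ℚ.< δ → ∃[ k ] 1ℚ ℚ.< multiples δ k
archimedean {δ@(mkℚ (+ suc n) b-1 _)} _ = k ,
  ℚ.toℚᵘ-cancel-< (ℚᵘ.<-respʳ-≃ (ℚᵘ.≃-sym (multiples-≃ δ k))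
    (ℚᵘ.*<* (subst₂ ℤ._<_ (sym (ℤ.*-identityˡ (+ suc b-1))) (sym (ℤ.*-identityʳ (+ k ℤ.* + suc n)))
      (ℤ.+<+ (ℕ.<-≤-trans (ℕ.n<1+n _) (ℕ.m≤m*n k (suc n)))))))
  where
  -- One more than the denominator of `δ`; the numerator of `δ` is at least 1, so `k` steps exceed
  -- 1.
  k = suc (suc b-1)
archimedean {mkℚ (+ zero) b-1 _} (ℚ.*<* (ℤ.+<+ ()))
archimedean {mkℚ -[1+ n ] b-1 _} (ℚ.*<* ())

module _ where
  open +-*-Solver

  p+[q-p]≡q : ∀ p q → p ℚ.+ (q ℚ.- p) ≡ q
  p+[q-p]≡q = solve 2 (λ p q → p :+ (q :- p) := q) refl

  q+[r-[q+p]]≡r-p : ∀ p q r → q ℚ.+ (r ℚ.- (q ℚ.+ p)) ≡ r ℚ.- p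
  q+[r-[q+p]]≡r-p = solve 3 (λ p q r → q :+ (r :- (q :+ p)) := r :- p) refl

  [a-[e-h]]+[b-[h-g]]≡[a+b]-[e-g] : ∀ a b e h g → (a ℚ.- (e ℚ.- h)) ℚ.+ (b ℚ.- (h ℚ.- g)) ≡ (a ℚ.+ b) ℚ.- (e ℚ.- g)
  [a-[e-h]]+[b-[h-g]]≡[a+b]-[e-g] =
    solve 5 (λ a b e h g → (a :- (e :- h)) :+ (b :- (h :- g)) := (a :+ b) :- (e :- g)) refl

  q-[q-p]≡p : ∀ p q → q ℚ.- (q ℚ.- p) ≡ p
  q-[q-p]≡p = solve 2 (λ p q → q :- (q :- p) := p) refl

p<q⇒0<q-p : ∀ {p q} → p ℚ.< q → 0ℚ ℚ.< q ℚ.- p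
p<q⇒0<q-p {p} {q} p<q = subst (ℚ._< q ℚ.- p) (ℚ.+-inverseʳ p) (ℚ.+-monoˡ-< (ℚ.- p) p<q)

p<q+r⇒p-q<r : ∀ {p q r} → p ℚ.< q ℚ.+ r → p ℚ.- q ℚ.< r
p<q+r⇒p-q<r {p} {q} {r} p<q+r = subst (p ℚ.- q ℚ.<_) eq (ℚ.+-monoˡ-< (ℚ.- q) p<q+r)
  where
  open +-*-Solver
  eq : (q ℚ.+ r) ℚ.- q ≡ r
  eq = solve 2 (λ q r → (q :+ r) :- q := r) refl q r

p-q<r⇒p<q+r : ∀ {p q r} → p ℚ.- q ℚ.< r → p ℚ.< q ℚ.+ r
p-q<r⇒p<q+r {p} {q} {r} p-q<r = subst (ℚ._< q ℚ.+ r) (p+[q-p]≡q q p) (ℚ.+-monoʳ-< q p-q<r)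

p-q<p : ∀ {p q} → 0ℚ ℚ.< q → p ℚ.- q ℚ.< p
p-q<p {p} {q} 0<q = subst (p ℚ.- q ℚ.<_) (ℚ.+-identityʳ p) (ℚ.+-monoʳ-< p (ℚ.neg-antimono-< 0<q))

-- Choose `a` between `q − s` and `r`, then `b` between `q − a` and `s`. This is the form of witness
-- that `_+ᴿ_` demands.
split-< : ∀ {q r s} → q ℚ.< r ℚ.+ s → ∃[ a ] ∃[ b ] (a ℚ.< r × b ℚ.< s × q ℚ.< a ℚ.+ b)
split-< {q} {r} {s} q<r+s =
  let (a , q-s<a , a<r) = ℚ.<-dense (p<q+r⇒p-q<r {q} {s} {r} (subst (q ℚ.<_) (ℚ.+-comm r s) q<r+s))
      (b , q-a<b , b<s) = ℚ.<-dense (p<q+r⇒p-q<r {q} {a} {s}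
          (subst (q ℚ.<_) (ℚ.+-comm s a) (p-q<r⇒p<q+r {q} {s} {a} q-s<a)))
  in a , b , a<r , b<s , p-q<r⇒p<q+r {q} {a} {b} q-a<b

-- The number `k / (k + 1)` is entered in lowest terms so that `↥` and `↧` compute to `+ k` and
-- `+ suc k`, the integers that occur in the counting lemmas.
level : ℕ → ℚ
level k = mkℚ (+ k) k λ {i} (i∣k , i∣1+k) →
  ∣1⇒≡1 (∣m+n∣m⇒∣n (subst (i ∣_) (ℕ.+-comm 1 k) i∣1+k) i∣k)

-- A fraction below 1 with denominator `b` is at most `(b − 1) / b`, and `(b − 1)(b + 1) < b²`
-- places this below `b / (b + 1)`.
<-level : ∀ {q} → q ℚ.< 1ℚ → ∃[ k ] q ℚ.< level k
<-level {mkℚ n b-1 _} (ℚ.*<* n<b) = b , ℚ.*<* (ℤ.≤-<-trans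
    (ℤ.*-monoʳ-≤-nonNeg (+ suc b) (≤-by {x = n} {+ b ℤ.- + 1}
        (ℤ.i≤j⇒0≤j-i (ℤ.i<j⇒suc[i]≤j (subst₂ ℤ._<_ (ℤ.*-identityʳ n) (ℤ.*-identityˡ (+ b)) n<b))) (eq n (+ b))))
    (≤⇒< (+ b)))
  where
  b = suc b-1
  eq : ∀ n b → b ℤ.- (+ 1 ℤ.+ n) ≡ (b ℤ.- + 1) ℤ.- n
  eq = ℤ-Solver.solve-∀
  ≤⇒< : ∀ b → (b ℤ.- + 1) ℤ.* (+ 1 ℤ.+ b) ℤ.< b ℤ.* b
  ≤⇒< b = subst ((b ℤ.- + 1) ℤ.* (+ 1 ℤ.+ b) ℤ.<_) (eq′ b) (ℤ.suc[i]≤j⇒i<j ℤ.≤-refl)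
    where
    eq′ : ∀ b → + 1 ℤ.+ (b ℤ.- + 1) ℤ.* (+ 1 ℤ.+ b) ≡ b ℤ.* b
    eq′ = ℤ-Solver.solve-∀

-- Translations and inequalities between products.

infixl 6 _∔_

_∔_ : Vec ℤ d → Vec ℤ d → Vec ℤ d
_∔_ = Vec.zipWith ℤ._+_

𝟎 : Vec ℤ d
𝟎 = Vec.replicate _ (+ 0)

Near-∔⁺ : ∀ {n} (e : Vec ℤ d) {w} → (∀ i → ℤ.- n ℤ.≤ Vec.lookup w i × Vec.lookup w i ℤ.≤ n) → Near n e (e ∔ w)
Near-∔⁺ [] {[]} _ = []
Near-∔⁺ (a ∷ e) {b ∷ w} bounds =
  (ℤ.+-monoʳ-≤ a (proj₁ (bounds zero)) , ℤ.+-monoʳ-≤ a (proj₂ (bounds zero))) ∷ Near-∔⁺ e (bounds ∘ suc)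

Near-∔⁻ : ∀ {n} {e y : Vec ℤ d} → Near n e y →
          ∃[ w ] (y ≡ e ∔ w × (∀ i → ℤ.- n ℤ.≤ Vec.lookup w i × Vec.lookup w i ℤ.≤ n))
Near-∔⁻ [] = [] , refl , λ ()
Near-∔⁻ {n = n} (_∷_ {x = a} {y = b} (p , q) r) = let (w , y≡ , bounds) = Near-∔⁻ r in
  (b ℤ.- a) ∷ w , cong₂ _∷_ (eq₁ a b) y≡ ,
  λ { zero    → ≤-by (ℤ.i≤j⇒0≤j-i p) (eq₂ a b n) , ≤-by (ℤ.i≤j⇒0≤j-i q) (eq₃ a b n)
    ; (suc i) → bounds i }
  where
  eq₁ : ∀ a b → b ≡ a ℤ.+ (b ℤ.- a)
  eq₁ = ℤ-Solver.solve-∀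
  eq₂ : ∀ a b n → b ℤ.- (a ℤ.- n) ≡ (b ℤ.- a) ℤ.- ℤ.- n
  eq₂ = ℤ-Solver.solve-∀
  eq₃ : ∀ a b n → (a ℤ.+ n) ℤ.- b ≡ n ℤ.- (b ℤ.- a)
  eq₃ = ℤ-Solver.solve-∀

+*≤+*⁻ : ∀ a b c e → + a ℤ.* + b ℤ.≤ + c ℤ.* + e → a ℕ.* b ≤ c ℕ.* e
+*≤+*⁻ a b c e p = ℤ.drop‿+≤+ (subst₂ ℤ._≤_ (sym (ℤ.pos-* a b)) (sym (ℤ.pos-* c e)) p)

+*≤+*⁺ : ∀ a b c e → a ℕ.* b ≤ c ℕ.* e → + a ℤ.* + b ℤ.≤ + c ℤ.* + e
+*≤+*⁺ a b c e p = subst₂ ℤ._≤_ (ℤ.pos-* a b) (ℤ.pos-* c e) (ℤ.+≤+ p)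

+*<+*⁻ : ∀ a b c e → + a ℤ.* + b ℤ.< + c ℤ.* + e → a ℕ.* b < c ℕ.* e
+*<+*⁻ a b c e p = ℤ.drop‿+<+ (subst₂ ℤ._<_ (sym (ℤ.pos-* a b)) (sym (ℤ.pos-* c e)) p)

+*<+*⁺ : ∀ a b c e → a ℕ.* b < c ℕ.* e → + a ℤ.* + b ℤ.< + c ℤ.* + e
+*<+*⁺ a b c e p = subst₂ ℤ._<_ (ℤ.pos-* a b) (ℤ.pos-* c e) (ℤ.+<+ p)

1≤⇒pos : ∀ {z} → + 1 ℤ.≤ z → ∃[ n ] z ≡ + suc n
1≤⇒pos {+ suc n} _ = n , refl
1≤⇒pos {+ zero} (ℤ.+≤+ ())

0<vol : ∀ d n → 0 < vol d n
0<vol d n = ℕ.m^n>0 (suc (n ℕ.+ n)) d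

-- Dilations, annuli and bad centres in ℤᵈ.

module Standard (lem : ExcludedMiddle 0ℓ) where

  ⌊⌋⁺ : ∀ {A : Set} → A → T ⌊ lem {A} ⌋
  ⌊⌋⁺ = fromWitness {a? = lem}

  ⌊⌋⁻ : ∀ {A : Set} → T ⌊ lem {A} ⌋ → A
  ⌊⌋⁻ = toWitness {a? = lem}

  -- The set E + [-u , u]ᵈ.
  dil : (Vec ℤ d → Bool) → ℤ → Vec ℤ d → Bool
  dil E u y = ⌊ lem {∃[ e ] (T (E e) × T (box e u y))} ⌋

  Dense : ℕ → (Vec ℤ d → Bool) → Vec ℤ d → ℕ → Set
  Dense m S y n = card lem (box y (+ n)) ℤ.≤ + m ℤ.* card lem (box y (+ n) ⊓ S)

  -- The points of [-H , H]ᵈ that are centres of boxes of which at least 1 / m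
  -- is occupied by the annulus (E + [-v , v]ᵈ) ∖ (E + [-u , u]ᵈ).
  bad : ℕ → (Vec ℤ d → Bool) → ℤ → ℤ → ℤ → Vec ℤ d → Bool
  bad m E u v H y = ⌊ lem {T (box 𝟎 H y) × ∃ (Dense m (dil E v ─ dil E u) y)} ⌋

  near : (Vec ℤ d → Bool) → ℤ → Vec ℤ d → ℤ → Vec ℤ d → Bool
  near E u x ν = dil E u ⊓ box x ν

  0≤card : (S : Vec ℤ d → Bool) → + 0 ℤ.≤ card lem S
  0≤card S with lem {∃[ n ] (Fin n ↔ ∃ (T ∘ S))}
  ... | yes _ = ℤ.+≤+ z≤n
  ... | no _  = ℤ.+≤+ z≤n

  card-∅ : {S : Vec ℤ d → Bool} → (∀ x → ¬ T (S x)) → card lem S ≡ + 0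
  card-∅ {S = S} empty = card-count {S = S} {L = []} [] (λ x s → contradiction s (empty x)) lem

  module _ {x : Vec ℤ d} {ν} (1≤ν : + 1 ℤ.≤ ν) where

    1≤card-box : + 1 ℤ.≤ card lem (box x ν)
    1≤card-box with 1≤⇒pos 1≤ν
    ... | n , refl = subst (+ 1 ℤ.≤_) (sym (card-box lem x (suc n))) (ℤ.+≤+ (0<vol d (suc n)))

    module _ {R S : Vec ℤ d → Bool} (R⊑ : R ⊑ box x ν) (S⊑ : S ⊑ box x ν) where

      card-mono : R ⊑ S → card lem R ℤ.≤ card lem S
      card-mono R⊑S with 1≤⇒pos 1≤ν
      ... | n , refl = subst₂ ℤ._≤_ (sym (card-in-box lem R⊑)) (sym (card-in-box lem S⊑))
        (ℤ.+≤+ (count-mono R⊑S (boxList x (suc n))))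

      card-⊔ : card lem (R ⊔ S) ℤ.≤ card lem R ℤ.+ card lem S
      card-⊔ with 1≤⇒pos 1≤ν
      ... | n , refl = subst₂ ℤ._≤_ (sym (card-in-box lem λ y → [ R⊑ y , S⊑ y ]′ ∘ Equivalence.to T-∨))
        (sym (cong₂ ℤ._+_ (card-in-box lem R⊑) (card-in-box lem S⊑)))
        (ℤ.+≤+ (count-⊔ R S (boxList x (suc n))))

      card-─ : card lem R ℤ.≤ card lem S ℤ.+ card lem (R ─ S)
      card-─ with 1≤⇒pos 1≤ν
      ... | n , refl = subst₂ ℤ._≤_ (sym (card-in-box lem R⊑))
        (sym (cong₂ ℤ._+_ (card-in-box lem S⊑) (card-in-box lem λ y → R⊑ y ∘ proj₁ ∘ ─⁻ {S = R} {S})))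
        (ℤ.+≤+ (ℕ.≤-trans (ℕ.≤-reflexive (count-split R S (boxList x (suc n))))
          (ℕ.+-monoˡ-≤ _ (count-mono (λ y → proj₂ ∘ ⊓⁻ {S = R} {S}) (boxList x (suc n))))))

  dil-mono : {E : Vec ℤ d → Bool} {u v : ℤ} → u ℤ.≤ v → dil E u ⊑ dil E v
  dil-mono u≤v y t = let (e , Ee , n) = ⌊⌋⁻ t in ⌊⌋⁺ (e , Ee , box⁺ (Near-mono u≤v (box⁻ n)))

  module _ {E : Vec ℤ d → Bool} {h} (E⊑ : E ⊑ box 𝟎 (+ h)) where

    dil⊑ : ∀ {u} → u ≤ h → dil E (+ u) ⊑ box 𝟎 (+ (h ℕ.+ h))
    dil⊑ u≤h y t = let (e , Ee , n) = ⌊⌋⁻ t in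
      box⁺ (Near-mono (ℤ.+≤+ (ℕ.+-monoʳ-≤ h u≤h)) (Near-trans (box⁻ (E⊑ e Ee)) (box⁻ n)))

    private
      -- Every dilation of `E` by at most `h` fits in the doubled box, so all their cardinalities
      -- become counts over this one list.
      L = boxList (𝟎 {d}) (h ℕ.+ h)

    card-dil : ∀ {u} → u ≤ h → card lem (dil E (+ u)) ≡ + count (dil E (+ u)) L
    card-dil u≤h = card-in-box lem (dil⊑ u≤h)

    count-dil : ∀ {u} → u ≤ h → count (dil E (+ u)) L ≤ 2 ℕ.^ d ℕ.* vol d h
    count-dil u≤h = ℕ.≤-trans (count-mono (dil⊑ u≤h) L)
      (ℕ.≤-trans (count-box (boxList-unique (𝟎 {d}) (h ℕ.+ h)) 𝟎 (h ℕ.+ h)) (vol-double d h))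

    count-bad : ∀ {m u v} → v ≤ h →
                count (bad m E (+ u) (+ v) (+ h)) (boxList 𝟎 h) ≤
                2 ℕ.^ d ℕ.* (m ℕ.* count (dil E (+ v) ─ dil E (+ u)) L)
    count-bad {m} {u} {v} v≤h = vitali m L ρ _ C (filter (T? ∘ B) (boxList 𝟎 h)) ℕ.≤-refl
      (filter⁺ (T? ∘ B) (boxList-unique 𝟎 h)) λ y∈ → ρ-dense _ (proj₂ (∈-filter⁻ (T? ∘ B) {xs = boxList 𝟎 h} y∈))
      where
      B C : Vec ℤ d → Bool
      B = bad m E (+ u) (+ v) (+ h)
      C = dil E (+ v) ─ dil E (+ u)

      ρ : Vec ℤ d → ℕ
      ρ y with T? (B y)
      ... | yes t = proj₁ (proj₂ (⌊⌋⁻ t))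
      -- A default radius; `vitali` is applied only to centres in `B`.
      ... | no _  = 0

      Dense⇒count : ∀ y n → Dense m C y n → vol d n ≤ m ℕ.* count (box y (+ n) ⊓ C) L
      Dense⇒count y n dense = ℤ.drop‿+≤+ (subst₂ ℤ._≤_ (card-box lem y n)
        (trans (cong (+ m ℤ.*_) (card-count (boxList-unique 𝟎 (h ℕ.+ h)) C⊑ lem)) (sym (ℤ.pos-* m _)))
        dense)
        where
        -- The radius `n` is unbounded here; the intersection stays inside `L` because the annulus
        -- already lies there.
        C⊑ : ∀ z → T ((box y (+ n) ⊓ C) z) → z ∈ˡ L
        C⊑ z t = ∈-boxList⁺ (box⁻ (dil⊑ v≤h z (proj₁ (─⁻ {S = dil E (+ v)} {dil E (+ u)}
            (proj₂ (⊓⁻ {S = box y (+ n)} {C} t))))))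

      ρ-dense : ∀ y → T (B y) → vol d (ρ y) ≤ m ℕ.* count (box y (+ ρ y) ⊓ C) L
      ρ-dense y t with T? (B y)
      ... | yes t = Dense⇒count y _ (proj₂ (proj₂ (⌊⌋⁻ t)))
      ... | no ¬t = contradiction t ¬t

  -- Supplies the starting value in the search for the integer part of
  -- `N |E + [-u , u]ᵈ| / |[-H , H]ᵈ|`; the additional 1 makes the bound strict.
  card-dil-bounded : ∀ N {E : Vec ℤ d → Bool} {H u} → E ⊑ box 𝟎 H → + 1 ℤ.≤ u → u ℤ.≤ H →
    + N ℤ.* card lem (dil E u) ℤ.< + suc (N ℕ.* 2 ℕ.^ d) ℤ.* card lem (box (𝟎 {d}) H)
  card-dil-bounded {d} N {E} {H} E⊑ 1≤u u≤H with 1≤⇒pos 1≤u | 1≤⇒pos (ℤ.≤-trans 1≤u u≤H)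
  ... | u , refl | h , refl = subst₂ (λ p q → + N ℤ.* p ℤ.< + suc (N ℕ.* 2 ℕ.^ d) ℤ.* q)
    (sym (card-dil {E = E} E⊑ (ℤ.drop‿+≤+ u≤H))) (sym (card-box lem 𝟎 (suc h)))
    (+*<+*⁺ N _ (suc (N ℕ.* 2 ℕ.^ d)) (vol d (suc h)) (ℕ.≤-<-trans
        (ℕ.*-monoʳ-≤ N (count-dil {E = E} E⊑ (ℤ.drop‿+≤+ u≤H)))
      (subst (ℕ._< suc (N ℕ.* 2 ℕ.^ d) ℕ.* vol d (suc h)) (ℕ.*-assoc N (2 ℕ.^ d) _)
        (ℕ.m<n+m _ (0<vol d (suc h))))))

  -- Write V for the size of the large box. The two hypotheses trap `N` times the sizes of both
  -- dilations in `[kV , (k+1)V)`, so `N |C| < V` for the annulus C. Since the bad centres number at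
  -- most `2ᵈ m |C|`, multiplying by `b` produces exactly `N |C|`, and `e ≥ 1` finishes.
  card-bad : ∀ k m b {e} {E : Vec ℤ d → Bool} {H u v} → E ⊑ box 𝟎 H → + 1 ℤ.≤ e → + 1 ℤ.≤ u → u ℤ.≤ v → v ℤ.≤ H →
    + k ℤ.* card lem (box (𝟎 {d}) H) ℤ.≤ + (2 ℕ.^ d ℕ.* (m ℕ.* b)) ℤ.* card lem (dil E u) →
    + (2 ℕ.^ d ℕ.* (m ℕ.* b)) ℤ.* card lem (dil E v) ℤ.< + suc k ℤ.* card lem (box (𝟎 {d}) H) →
    card lem (bad m E u v H) ℤ.* + b ℤ.≤ e ℤ.* card lem (box (𝟎 {d}) H)
  card-bad {d} k m b {e} {E} E⊑ 1≤e 1≤u u≤v v≤H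
    with 1≤⇒pos 1≤u | 1≤⇒pos (ℤ.≤-trans 1≤u u≤v) | 1≤⇒pos (ℤ.≤-trans (ℤ.≤-trans 1≤u u≤v) v≤H) | 1≤⇒pos 1≤e
  ... | u , refl | v , refl | h , refl | e , refl = proof
    where
    N = 2 ℕ.^ d ℕ.* (m ℕ.* b)
    L = boxList (𝟎 {d}) (suc h ℕ.+ suc h)
    Eu Ev C B : Vec ℤ d → Bool
    Eu = dil E (+ suc u)
    Ev = dil E (+ suc v)
    C = Ev ─ Eu
    B = bad m E (+ suc u) (+ suc v) (+ suc h)
    V = vol d (suc h)
    v≤h = ℤ.drop‿+≤+ v≤H
    u≤h = ℕ.≤-trans (ℤ.drop‿+≤+ u≤v) v≤h

    C+Eu≤Ev : count C L ℕ.+ count Eu L ≤ count Ev L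
    C+Eu≤Ev = ℕ.≤-trans
      (ℕ.+-monoʳ-≤ (count C L) (count-mono (λ y t → ⊓⁺ {S = Ev} {Eu} (dil-mono {E = E} u≤v y t) t) L))
      (ℕ.≤-reflexive (trans (ℕ.+-comm (count C L) _) (sym (count-split Ev Eu L))))

    NC<V : k ℕ.* V ≤ N ℕ.* count Eu L → N ℕ.* count Ev L < suc k ℕ.* V → N ℕ.* count C L < V
    NC<V lower upper = ℕ.+-cancelʳ-< (k ℕ.* V) _ _ (begin-strict
      N ℕ.* count C L ℕ.+ k ℕ.* V               ≤⟨ ℕ.+-monoʳ-≤ (N ℕ.* count C L) lower ⟩
      N ℕ.* count C L ℕ.+ N ℕ.* count Eu L       ≡⟨ sym (ℕ.*-distribˡ-+ N _ _) ⟩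
      N ℕ.* (count C L ℕ.+ count Eu L)           ≤⟨ ℕ.*-monoʳ-≤ N C+Eu≤Ev ⟩
      N ℕ.* count Ev L                           <⟨ upper ⟩
      V ℕ.+ k ℕ.* V                              ∎)
      where open ℕ.≤-Reasoning

    bound : k ℕ.* V ≤ N ℕ.* count Eu L → N ℕ.* count Ev L < suc k ℕ.* V →
            count B (boxList 𝟎 (suc h)) ℕ.* b ≤ suc e ℕ.* V
    bound lower upper = begin
      count B (boxList 𝟎 (suc h)) ℕ.* b         ≤⟨ ℕ.*-monoˡ-≤ b (count-bad {E = E} E⊑ {m} v≤h) ⟩
      2 ℕ.^ d ℕ.* (m ℕ.* count C L) ℕ.* b       ≡⟨ eq (2 ℕ.^ d) m (count C L) b ⟩
      N ℕ.* count C L                           ≤⟨ ℕ.<⇒≤ (NC<V lower upper) ⟩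
      V                                         ≤⟨ ℕ.m≤m+n V _ ⟩
      suc e ℕ.* V                               ∎
      where
      open ℕ.≤-Reasoning
      eq : ∀ p m c b → p ℕ.* (m ℕ.* c) ℕ.* b ≡ p ℕ.* (m ℕ.* b) ℕ.* c
      eq = ℕ-Solver.solve-∀

    proof : + k ℤ.* card lem (box (𝟎 {d}) (+ suc h)) ℤ.≤ + N ℤ.* card lem Eu →
            + N ℤ.* card lem Ev ℤ.< + suc k ℤ.* card lem (box (𝟎 {d}) (+ suc h)) →
            card lem B ℤ.* + b ℤ.≤ + suc e ℤ.* card lem (box (𝟎 {d}) (+ suc h))
    proof lower upper
      rewrite card-dil {E = E} E⊑ u≤h | card-dil {E = E} E⊑ v≤h | card-box lem (𝟎 {d}) (suc h)
            | card-in-box lem {S = B} {x = 𝟎} {n = suc h} (λ _ → proj₁ ∘ ⌊⌋⁻)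
      = +*≤+*⁺ (count B (boxList 𝟎 (suc h))) b (suc e) V
          (bound (+*≤+*⁻ k V N (count Eu L) lower) (+*<+*⁻ N (count Ev L) (suc k) V upper))

  bad⁺ : ∀ k {E : Vec ℤ d → Bool} {H} {x e w} {u ξ ν v} → T (box 𝟎 H x) → T (E e) → x ≡ e ∔ w →
    (∀ i → ℤ.- ξ ℤ.≤ Vec.lookup w i × Vec.lookup w i ℤ.≤ ξ) →
    + 1 ℤ.≤ ν → ν ℤ.≤ ξ → ξ ℤ.+ ξ ℤ.≤ v →
    card lem (near E u x ν) ℤ.* + suc k ℤ.≤ + k ℤ.* card lem (box x ν) →
    T (bad (suc k) E u v H x)
  bad⁺ {d} k {E} {H} {x} {e} {w} {u} {ξ} {_} {v} Fx Ee refl small 1≤ν ν≤ξ 2ξ≤v sparse with 1≤⇒pos 1≤ν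
  ... | n-1 , refl = ⌊⌋⁺ (Fx , n , dense)
    where
    n = suc n-1
    L = boxList x n
    Q C R : Vec ℤ d → Bool
    Q = box x (+ n)
    C = dil E v ─ dil E u
    R = near E u x (+ n)
    cQ = count Q L

    -- From `e` to the centre is at most `ξ`, and from the centre to a point of the box at most
    -- `ν ≤ ξ`. This is why `ξ` is half of `v`.
    Q⊑dil : Q ⊑ dil E v
    Q⊑dil y t = ⌊⌋⁺ (e , Ee , box⁺ (Near-mono (ℤ.≤-trans (ℤ.+-monoʳ-≤ ξ ν≤ξ) 2ξ≤v)
        (Near-trans (Near-∔⁺ e small) (box⁻ t))))

    Q≤R+Q⊓C : cQ ≤ count R L ℕ.+ count (Q ⊓ C) L
    Q≤R+Q⊓C = ℕ.≤-trans (ℕ.≤-reflexive (count-split Q (dil E u) L)) (ℕ.+-mono-≤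
      (count-mono (λ y t → let (q , s) = ⊓⁻ {S = Q} {dil E u} t in ⊓⁺ {S = dil E u} {Q} s q) L)
      (count-mono (λ y t → let (q , ¬s) = ─⁻ {S = Q} {dil E u} t in
        ⊓⁺ {S = Q} {C} q (─⁺ {S = dil E v} {dil E u} (Q⊑dil y q) ¬s)) L))

    bound : count R L ℕ.* suc k ≤ k ℕ.* cQ → cQ ≤ suc k ℕ.* count (Q ⊓ C) L
    -- Adding `k * cQ` to both sides avoids subtraction in ℕ when the sparse share `k / (k + 1)` is
    -- taken off the whole box.
    bound sparse = ℕ.+-cancelʳ-≤ (k ℕ.* cQ) _ _ (begin
      cQ ℕ.+ k ℕ.* cQ                                        ≤⟨ ℕ.*-monoʳ-≤ (suc k) Q≤R+Q⊓C ⟩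
      suc k ℕ.* (count R L ℕ.+ count (Q ⊓ C) L)              ≡⟨ eq (suc k) (count R L) (count (Q ⊓ C) L) ⟩
      suc k ℕ.* count (Q ⊓ C) L ℕ.+ count R L ℕ.* suc k       ≤⟨ ℕ.+-monoʳ-≤ (suc k ℕ.* count (Q ⊓ C) L) sparse ⟩
      suc k ℕ.* count (Q ⊓ C) L ℕ.+ k ℕ.* cQ                 ∎)
      where
      open ℕ.≤-Reasoning
      eq : ∀ m r c → m ℕ.* (r ℕ.+ c) ≡ m ℕ.* c ℕ.+ r ℕ.* m
      eq = ℕ-Solver.solve-∀

    cardQ : card lem Q ≡ + cQ
    cardQ = card-in-box lem {S = Q} {x = x} {n = n} (λ _ → id)

    cardR : card lem R ≡ + count R L
    cardR = card-in-box lem {S = R} {x = x} {n = n} (λ _ → proj₂ ∘ ⊓⁻ {S = dil E u} {Q})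

    cardQ⊓C : card lem (Q ⊓ C) ≡ + count (Q ⊓ C) L
    cardQ⊓C = card-in-box lem {S = Q ⊓ C} {x = x} {n = n} (λ _ → proj₁ ∘ ⊓⁻ {S = Q} {C})

    dense : card lem Q ℤ.≤ + suc k ℤ.* card lem (Q ⊓ C)
    dense = subst₂ ℤ._≤_ (sym cardQ) (trans (ℤ.pos-* (suc k) (count (Q ⊓ C) L))
        (cong (+ suc k ℤ.*_) (sym cardQ⊓C)))
      (ℤ.+≤+ (bound (+*≤+*⁻ (count R L) (suc k) k cQ (subst₂
          (λ p q → p ℤ.* + suc k ℤ.≤ + k ℤ.* q) cardR cardQ sparse))))

  near⁻ : {E : Vec ℤ d → Bool} {u : ℤ} {x y : Vec ℤ d} {ν : ℤ} → T (near E u x ν y) →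
    T (box x ν y) × ∃[ e ] ∃[ w ] (T (E e) × y ≡ e ∔ w × (∀ i → ℤ.- u ℤ.≤ Vec.lookup w i × Vec.lookup w i ℤ.≤ u))
  near⁻ {E = E} {u} {x} {ν = ν} t =
    let (s , q) = ⊓⁻ {S = dil E u} {box x ν} t
        (e , Ee , b) = ⌊⌋⁻ s
        (w , y≡ , small) = Near-∔⁻ (box⁻ b)
    in q , e , w , Ee , y≡ , small

  last-below : (R : ℤ → Set) → R (+ 1) → ∀ {H} → + 1 ℤ.≤ H →
               ∃[ v ] (+ 1 ℤ.≤ v × v ℤ.≤ H × R v × (v ≡ H ⊎ ¬ R (v ℤ.+ + 1)))
  last-below R R1 1≤H with 1≤⇒pos 1≤H
  ... | h , refl = go h
    where
    go : ∀ h → ∃[ v ] (+ 1 ℤ.≤ v × v ℤ.≤ + suc h × R v × (v ≡ + suc h ⊎ ¬ R (v ℤ.+ + 1)))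
    go zero = + 1 , ℤ.≤-refl , ℤ.≤-refl , R1 , inj₁ refl
    go (suc h) with go h
    ... | v , 1≤v , v≤h , Rv , inj₂ ¬R = v , 1≤v , ℤ.≤-trans v≤h (ℤ.+≤+ (ℕ.n≤1+n _)) , Rv , inj₂ ¬R
    ... | v , 1≤v , v≤h , Rv , inj₁ refl with lem {R (+ suc (suc h))}
    ...   | yes R′ = + suc (suc h) , ℤ.+≤+ (s≤s z≤n) , ℤ.≤-refl , R′ , inj₁ refl
    ...   | no ¬R′ = v , 1≤v , ℤ.+≤+ (ℕ.n≤1+n _) , Rv , inj₂ (¬R′ ∘ subst R (cong +_ (ℕ.+-comm (suc h) 1)))

≤⁺ : ∀ {a b} → a ℤ.≤ b → T ⌊ a ℤ.≤? b ⌋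
≤⁺ {a} {b} = fromWitness {a? = a ℤ.≤? b}

≤⁻ : ∀ a b → T ⌊ a ℤ.≤? b ⌋ → a ℤ.≤ b
≤⁻ a b = toWitness {a? = a ℤ.≤? b}

<⁺ : ∀ {a b} → a ℤ.< b → T ⌊ a ℤ.<? b ⌋
<⁺ {a} {b} = fromWitness {a? = a ℤ.<? b}

<⁻ : ∀ a b → T ⌊ a ℤ.<? b ⌋ → a ℤ.< b
<⁻ a b = toWitness {a? = a ℤ.<? b}

<⇒≱ : ∀ {p q} → p ℚ.< q → ¬ q ℚ.≤ p
<⇒≱ p<q q≤p = ℚ.<-irrefl refl (ℚ.<-≤-trans p<q q≤p)

-- Variables and abbreviations of the formal language.

module _ {Γ : List Ty} where

  private
    variable
      σ₀ σ₁ σ₂ σ₃ σ₄ σ₅ σ₆ σ₇ σ₈ : Ty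

  v0 : Term (σ₀ ∷ Γ) σ₀
  v0 = var (here refl)
  v1 : Term (σ₀ ∷ σ₁ ∷ Γ) σ₁
  v1 = var (there (here refl))
  v2 : Term (σ₀ ∷ σ₁ ∷ σ₂ ∷ Γ) σ₂
  v2 = var (there (there (here refl)))
  v3 : Term (σ₀ ∷ σ₁ ∷ σ₂ ∷ σ₃ ∷ Γ) σ₃
  v3 = var (there (there (there (here refl))))
  v4 : Term (σ₀ ∷ σ₁ ∷ σ₂ ∷ σ₃ ∷ σ₄ ∷ Γ) σ₄
  v4 = var (there (there (there (there (here refl)))))
  v5 : Term (σ₀ ∷ σ₁ ∷ σ₂ ∷ σ₃ ∷ σ₄ ∷ σ₅ ∷ Γ) σ₅
  v5 = var (there (there (there (there (there (here refl))))))
  v6 : Term (σ₀ ∷ σ₁ ∷ σ₂ ∷ σ₃ ∷ σ₄ ∷ σ₅ ∷ σ₆ ∷ Γ) σ₆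
  v6 = var (there (there (there (there (there (there (here refl)))))))
  v7 : Term (σ₀ ∷ σ₁ ∷ σ₂ ∷ σ₃ ∷ σ₄ ∷ σ₅ ∷ σ₆ ∷ σ₇ ∷ Γ) σ₇
  v7 = var (there (there (there (there (there (there (there (here refl))))))))
  v8 : Term (σ₀ ∷ σ₁ ∷ σ₂ ∷ σ₃ ∷ σ₄ ∷ σ₅ ∷ σ₆ ∷ σ₇ ∷ σ₈ ∷ Γ) σ₈
  v8 = var (there (there (there (there (there (there (there (there (here refl)))))))))

  infix  10 _≤′_ _<′_
  infixl 12 _+′_
  infixl 13 _*′_

  lit : ℤ → Term Γ ι
  lit = con ι

  _+′_ _*′_ : Term Γ ι → Term Γ ι → Term Γ ι
  a +′ b = con (ι ⇒ ι ⇒ ι) ℤ._+_ · a · b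
  a *′ b = con (ι ⇒ ι ⇒ ι) ℤ._*_ · a · b

  -′_ : Term Γ ι → Term Γ ι
  -′ a = con (ι ⇒ ι) ℤ.-_ · a

  _≤′_ _<′_ : Term Γ ι → Term Γ ι → Formula Γ
  a ≤′ b = b ∊ con (ι ⇒ P ι) (λ m n → ⌊ m ℤ.≤? n ⌋) · a
  a <′ b = b ∊ con (ι ⇒ P ι) (λ m n → ⌊ m ℤ.<? n ⌋) · a

  -- `Fin d` is no type of the hierarchy, so statements about all coordinates are unrolled into a
  -- finite conjunction. With no constant for truth, `⊥′ ⊃ ⊥′` stands for the empty one.
  ⋀ : ∀ n → (Fin n → Formula Γ) → Formula Γ
  ⋀ zero    φ = ⊥′ ⊃ ⊥′
  ⋀ (suc n) φ = φ zero ∧ ⋀ n (φ ∘ suc)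

module _ (𝔖 : Structure) {Γ} (ρ : All (Structure.El 𝔖) Γ) where
  open Structure 𝔖

  ⋀⁺ : ∀ n {φ : Fin n → Formula Γ} → (∀ i → Sat ρ (φ i)) → Sat ρ (⋀ n φ)
  ⋀⁺ zero    f = id
  ⋀⁺ (suc n) f = f zero , ⋀⁺ n (f ∘ suc)

  ⋀⁻ : ∀ n {φ : Fin n → Formula Γ} → Sat ρ (⋀ n φ) → ∀ i → Sat ρ (φ i)
  ⋀⁻ (suc n) (p , _) zero    = p
  ⋀⁻ (suc n) (_ , p) (suc i) = ⋀⁻ n p i

-- Transfer to hyperintegers and internal sets.

module Transferred (lem : ExcludedMiddle 0ℓ) (𝕌 : NonstandardUniverse) where

  open Nonstandard lem 𝕌
  open Standard lem

  -- `Sat` computes in both structures, so the stated types are definitionally the transferred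
  -- formulas. Standard data such as `d`, `N`, `k` or a rational stay outside the quantifiers: each
  -- value has its own instance of transfer.
  tr : (φ : Formula []) → Structure.Sat standard [] φ → Sat [] φ
  tr φ = Equivalence.to (transfer φ)

  -- Arithmetic of *ℤ

  ≤*-refl : ∀ a → a ≤* a
  ≤*-refl = tr (all′ ι (v0 ≤′ v0)) λ a → ≤⁺ ℤ.≤-refl

  ≤*-total : ∀ a b → a ≤* b ⊎ b ≤* a
  ≤*-total = tr (all′ ι (all′ ι (v1 ≤′ v0 ∨ v0 ≤′ v1))) λ a b → Sum.map ≤⁺ ≤⁺ (ℤ.≤-total a b)

  ≤*-<*-connex : ∀ a b → a ≤* b ⊎ b <* a
  ≤*-<*-connex = tr (all′ ι (all′ ι (v1 ≤′ v0 ∨ v0 <′ v1))) λ a b → Sum.map ≤⁺ <⁺ (Sum.map id ℤ.≰⇒> (connex a b))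
    where
    connex : ∀ a b → a ℤ.≤ b ⊎ ¬ a ℤ.≤ b
    connex a b with a ℤ.≤? b
    ... | yes p = inj₁ p
    ... | no ¬p = inj₂ ¬p

  <*⇒≱* : ∀ a b → a <* b → b ≤* a → ⊥
  <*⇒≱* = tr (all′ ι (all′ ι (v1 <′ v0 ⊃ v0 ≤′ v1 ⊃ ⊥′))) λ a b p q → ℤ.<⇒≱ (<⁻ a b p) (≤⁻ b a q)

  <*⇒≤* : ∀ a b → a <* b → a ≤* b
  <*⇒≤* = tr (all′ ι (all′ ι (v1 <′ v0 ⊃ v1 ≤′ v0))) λ a b p → ≤⁺ (ℤ.<⇒≤ (<⁻ a b p))

  +*-identityʳ : ∀ a → a +* ⋆ (+ 0) ≡ a
  +*-identityʳ = tr (all′ ι (v0 +′ lit (+ 0) ≐ v0)) ℤ.+-identityʳ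

  double≰* : ∀ a → ⋆ (+ 1) ≤* a → a +* a ≤* a → ⊥
  double≰* = tr (all′ ι (lit (+ 1) ≤′ v0 ⊃ v0 +′ v0 ≤′ v0 ⊃ ⊥′)) std
    where
    std : ∀ a → T ⌊ + 1 ℤ.≤? a ⌋ → T ⌊ a ℤ.+ a ℤ.≤? a ⌋ → ⊥
    std a p q with 1≤⇒pos (≤⁻ (+ 1) a p)
    ... | n , refl = ℕ.<⇒≱ (ℕ.m<m+n (suc n) (ℕ.s≤s ℕ.z≤n)) (ℤ.drop‿+≤+ (≤⁻ (a ℤ.+ a) a q))

  half* : ∀ v → ⋆ (+ 1) <* v → ∃[ ξ ] (⋆ (+ 1) ≤* ξ × ξ +* ξ ≤* v × v ≤* (ξ +* ξ) +* ⋆ (+ 1))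
  half* = tr (all′ ι (lit (+ 1) <′ v0 ⊃
      ex′ ι (lit (+ 1) ≤′ v0 ∧ v0 +′ v0 ≤′ v1 ∧ v1 ≤′ (v0 +′ v0) +′ lit (+ 1)))) std
    where
    half : ∀ n → 2 ℕ.≤ n → ∃[ k ] (1 ℕ.≤ k × k ℕ.+ k ℕ.≤ n × n ℕ.≤ (k ℕ.+ k) ℕ.+ 1)
    half (suc (suc zero)) _ = 1 , ℕ.≤-refl , ℕ.≤-refl , ℕ.n≤1+n _
    half (suc (suc (suc zero))) _ = 1 , ℕ.≤-refl , ℕ.n≤1+n _ , ℕ.≤-refl
    half (suc (suc n@(suc (suc _)))) _ = let (k , 1≤k , l , u) = half n (ℕ.s≤s (ℕ.s≤s ℕ.z≤n)) in
      suc k , ℕ.m≤n⇒m≤1+n 1≤k ,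
      subst (ℕ._≤ suc (suc n)) (cong suc (sym (ℕ.+-suc k k))) (ℕ.s≤s (ℕ.s≤s l)) ,
      subst (λ j → suc (suc n) ℕ.≤ suc j ℕ.+ 1) (sym (ℕ.+-suc k k)) (ℕ.s≤s (ℕ.s≤s u))
    half (suc zero) (ℕ.s≤s ())
    std : ∀ v → T ⌊ + 1 ℤ.<? v ⌋ →
          ∃[ ξ ] (T ⌊ + 1 ℤ.≤? ξ ⌋ × T ⌊ ξ ℤ.+ ξ ℤ.≤? v ⌋ × T ⌊ v ℤ.≤? (ξ ℤ.+ ξ) ℤ.+ + 1 ⌋)
    std v p with <⁻ (+ 1) v p
    std (+ n) _ | ℤ.+<+ 2≤n = let (k , a , b , c) = half n 2≤n in
      + k , ≤⁺ {+ 1} {+ k} (ℤ.+≤+ a) , ≤⁺ {+ (k ℕ.+ k)} {+ n} (ℤ.+≤+ b) , ≤⁺ {+ n} {+ ((k ℕ.+ k) ℕ.+ 1)} (ℤ.+≤+ c)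

  private
    1≤⇒0≤ : ∀ {a} → + 1 ℤ.≤ a → + 0 ℤ.≤ a
    1≤⇒0≤ = ℤ.≤-trans (ℤ.+≤+ ℕ.z≤n)

    -≤0 : ∀ {a} → + 0 ℤ.≤ a → ℤ.- a ℤ.≤ + 0
    -≤0 = ℤ.neg-mono-≤

  ∣-u∣≤* : ∀ u ξ → ⋆ (+ 1) ≤* u → u <* ξ → -* ξ ≤* -* u × -* u ≤* ξ
  ∣-u∣≤* = tr (all′ ι (all′ ι (lit (+ 1) ≤′ v1 ⊃ v1 <′ v0 ⊃ -′ v0 ≤′ -′ v1 ∧ -′ v1 ≤′ v0))) λ u ξ p q →
    let 1≤u = ≤⁻ (+ 1) u p ; u≤ξ = ℤ.<⇒≤ (<⁻ u ξ q) in
    ≤⁺ (ℤ.neg-mono-≤ u≤ξ) , ≤⁺ (ℤ.≤-trans (-≤0 (1≤⇒0≤ 1≤u)) (1≤⇒0≤ (ℤ.≤-trans 1≤u u≤ξ)))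

  ∣0∣≤* : ∀ ξ → ⋆ (+ 1) ≤* ξ → -* ξ ≤* ⋆ (+ 0) × ⋆ (+ 0) ≤* ξ
  ∣0∣≤* = tr (all′ ι (lit (+ 1) ≤′ v0 ⊃ -′ v0 ≤′ lit (+ 0) ∧ lit (+ 0) ≤′ v0)) λ ξ p →
    let 0≤ξ = 1≤⇒0≤ (≤⁻ (+ 1) ξ p) in ≤⁺ (-≤0 0≤ξ) , ≤⁺ 0≤ξ

  ∣u∣≤* : ∀ u ξ → ⋆ (+ 1) ≤* u → u <* ξ → -* ξ ≤* u × u ≤* ξ
  ∣u∣≤* = tr (all′ ι (all′ ι (lit (+ 1) ≤′ v1 ⊃ v1 <′ v0 ⊃ -′ v0 ≤′ v1 ∧ v1 ≤′ v0))) λ u ξ p q →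
    let 1≤u = ≤⁻ (+ 1) u p ; u≤ξ = ℤ.<⇒≤ (<⁻ u ξ q) in
    ≤⁺ (ℤ.≤-trans (-≤0 (1≤⇒0≤ (ℤ.≤-trans 1≤u u≤ξ))) (1≤⇒0≤ 1≤u)) , ≤⁺ u≤ξ

  sign-cases* : ∀ z u → -* u ≤* z → z ≤* u →
                (⋆ (+ 1) ≤* -* z × -* z ≤* u × z ≡ -* (-* z)) ⊎ z ≡ ⋆ (+ 0) ⊎ ⋆ (+ 1) ≤* z
  sign-cases* = tr (all′ ι (all′ ι (-′ v0 ≤′ v1 ⊃ v1 ≤′ v0 ⊃
      (lit (+ 1) ≤′ -′ v1 ∧ -′ v1 ≤′ v0 ∧ v1 ≐ -′ (-′ v1)) ∨ v1 ≐ lit (+ 0) ∨ lit (+ 1) ≤′ v1))) std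
    where
    std : ∀ z u → T ⌊ ℤ.- u ℤ.≤? z ⌋ → T ⌊ z ℤ.≤? u ⌋ →
          (T ⌊ + 1 ℤ.≤? ℤ.- z ⌋ × T ⌊ ℤ.- z ℤ.≤? u ⌋ × z ≡ ℤ.- (ℤ.- z)) ⊎ z ≡ + 0 ⊎ T ⌊ + 1 ℤ.≤? z ⌋
    std (+ zero)  u p q = inj₂ (inj₁ refl)
    std (+ suc n) u p q = inj₂ (inj₂ (≤⁺ {+ 1} {+ suc n} (ℤ.+≤+ (ℕ.s≤s ℕ.z≤n))))
    std -[1+ n ]  u p q = inj₁ (≤⁺ {+ 1} {+ suc n} (ℤ.+≤+ (ℕ.s≤s ℕ.z≤n)) ,
      ≤⁺ {+ suc n} {u} (subst (+ suc n ℤ.≤_) (ℤ.neg-involutive u) (ℤ.neg-mono-≤ (≤⁻ (ℤ.- u) -[1+ n ] p))) , refl)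

  -- r ≤ a / c and r ≥ a / c, multiplied out as in st[_/_].
  infix 4 _≤[_/_] _≥[_/_]

  _≤[_/_] _≥[_/_] : ℚ → *ℤ → *ℤ → Set
  r ≤[ a / c ] = ⋆ (↥ r) ** c ≤* a ** ⋆ (↧ r)
  r ≥[ a / c ] = a ** ⋆ (↧ r) ≤* ⋆ (↥ r) ** c

  sub-ratio* : ∀ r s x a b c → r ≤[ x / c ] → x ≤* a +* b → s ≥[ a / c ] → (r ℚ.- s) ≤[ b / c ]
  sub-ratio* r s = tr (all′ ι (all′ ι (all′ ι (all′ ι (lit (↥ r) *′ v0 ≤′ v3 *′ lit (↧ r) ⊃ v3 ≤′ v2 +′ v1 ⊃
      v2 *′ lit (↧ s) ≤′ lit (↥ s) *′ v0 ⊃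
      lit (↥ (r ℚ.- s)) *′ v0 ≤′ v1 *′ lit (↧ (r ℚ.- s))))))) λ x a b c p q t →
    ≤⁺ {↥ (r ℚ.- s) ℤ.* c} {b ℤ.* ↧ (r ℚ.- s)} (sub-ratio r s {x} {a} {b} {c} (≤⁻ (↥ r ℤ.* c) (x ℤ.* ↧ r) p)
        (≤⁻ x (a ℤ.+ b) q) (≤⁻ (a ℤ.* ↧ s) (↥ s ℤ.* c) t))

  ratio*≤1 : ∀ r → 1ℚ ℚ.< r → ∀ a c → ⋆ (+ 1) ≤* c → a ≤* c → ¬ r ≤[ a / c ]
  ratio*≤1 r 1<r = tr (all′ ι (all′ ι (lit (+ 1) ≤′ v0 ⊃ v1 ≤′ v0 ⊃
      lit (↥ r) *′ v0 ≤′ v1 *′ lit (↧ r) ⊃ ⊥′))) λ a c p q t →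
    <⇒≱ 1<r (ratio≤1 {r} {a} {c} (≤⁻ (+ 1) c p) (≤⁻ a c q) (≤⁻ (↥ r ℤ.* c) (a ℤ.* ↧ r) t))

  ratio*≤0 : ∀ r → 0ℚ ℚ.< r → ∀ c → ⋆ (+ 1) ≤* c → ¬ r ≤[ ⋆ (+ 0) / c ]
  ratio*≤0 r 0<r = tr (all′ ι (lit (+ 1) ≤′ v0 ⊃ lit (↥ r) *′ v0 ≤′ lit (+ 0) *′ lit (↧ r) ⊃ ⊥′)) λ c p t →
    <⇒≱ 0<r (ratio≤0 {r} {c} (≤⁻ (+ 1) c p) (≤⁻ (↥ r ℤ.* c) (+ 0 ℤ.* ↧ r) t))

  0≤ratio* : ∀ a c → ⋆ (+ 0) ≤* a → 0ℚ ≤[ a / c ]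
  0≤ratio* = tr (all′ ι (all′ ι (lit (+ 0) ≤′ v1 ⊃ lit (+ 0) *′ v0 ≤′ v1 *′ lit (+ 1)))) λ a c p →
    ≤⁺ {+ 0 ℤ.* c} {a ℤ.* + 1} (subst (+ 0 ℤ.≤_) (sym (ℤ.*-identityʳ a)) (≤⁻ (+ 0) a p))

  module _ {d : ℕ} where

    private
      S = P (ι ^ d)

      module _ {Γ : List Ty} where

        card′ : Term Γ S → Term Γ ι
        card′ D = con (S ⇒ ι) (card lem) · D

        box′ : Term Γ (ι ^ d) → Term Γ ι → Term Γ S
        box′ x n = con (ι ^ d ⇒ ι ⇒ S) box · x · n

        𝟎′ : Term Γ (ι ^ d)
        𝟎′ = con (ι ^ d) (Vec.replicate d (+ 0))

        infix 9 _⊑′_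
        _⊑′_ : Term (ι ^ d ∷ Γ) S → Term (ι ^ d ∷ Γ) S → Formula Γ
        A ⊑′ B = all′ (ι ^ d) (v0 ∊ A ⊃ v0 ∊ B)

        _⊔′_ _─′_ : Term Γ S → Term Γ S → Term Γ S
        A ⊔′ B = con (S ⇒ S ⇒ S) _⊔_ · A · B
        A ─′ B = con (S ⇒ S ⇒ S) _─_ · A · B

        dil′ : Term Γ S → Term Γ ι → Term Γ S
        dil′ E u = con (S ⇒ ι ⇒ S) dil · E · u

        near′ : Term Γ S → Term Γ ι → Term Γ (ι ^ d) → Term Γ ι → Term Γ S
        near′ E u x ν = con (S ⇒ ι ⇒ ι ^ d ⇒ ι ⇒ S) near · E · u · x · ν

        bad′ : ℕ → Term Γ S → Term Γ ι → Term Γ ι → Term Γ ι → Term Γ S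
        bad′ m E u v H = con (S ⇒ ι ⇒ ι ⇒ ι ⇒ S) (bad m) · E · u · v · H

        coord′ : Fin d → Term Γ (ι ^ d) → Term Γ ι
        coord′ i x = con (ι ^ d ⇒ ι) (λ v → Vec.lookup v i) · x

        _⊕′_ : Term Γ (ι ^ d) → Term Γ (ι ^ d) → Term Γ (ι ^ d)
        x ⊕′ y = con (ι ^ d ⇒ ι ^ d ⇒ ι ^ d) (Vec.zipWith ℤ._+_) · x · y

    _∪*_ _∖*_ : Internal d → Internal d → Internal d
    A ∪* B = name (S ⇒ S ⇒ S) _⊔_ ∙ A ∙ B
    A ∖* B = name (S ⇒ S ⇒ S) _─_ ∙ A ∙ B

    dil* : Internal d → *ℤ → Internal d
    dil* E u = name (S ⇒ ι ⇒ S) dil ∙ E ∙ u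

    near* : Internal d → *ℤ → *ℤ^ d → *ℤ → Internal d
    near* E u x ν = name (S ⇒ ι ⇒ ι ^ d ⇒ ι ⇒ S) near ∙ E ∙ u ∙ x ∙ ν

    bad* : ℕ → Internal d → *ℤ → *ℤ → *ℤ → Internal d
    bad* m E u v H = name (S ⇒ ι ⇒ ι ⇒ ι ⇒ S) (bad m) ∙ E ∙ u ∙ v ∙ H

    ∪*⁻ : ∀ A B x → x ∈ A ∪* B → x ∈ A ⊎ x ∈ B
    ∪*⁻ = tr (all′ S (all′ S (all′ (ι ^ d) (v0 ∊ v2 ⊔′ v1 ⊃ v0 ∊ v2 ∨ v0 ∊ v1)))) λ A B x → Equivalence.to T-∨

    ∪*⁺ : ∀ A B x → x ∈ A ⊎ x ∈ B → x ∈ A ∪* B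
    ∪*⁺ = tr (all′ S (all′ S (all′ (ι ^ d) (v0 ∊ v2 ∨ v0 ∊ v1 ⊃ v0 ∊ v2 ⊔′ v1)))) λ A B x → Equivalence.from T-∨

    ∖*⁻ : ∀ A B x → x ∈ A ∖* B → x ∈ A × ¬ x ∈ B
    ∖*⁻ = tr (all′ S (all′ S (all′ (ι ^ d) (v0 ∊ v2 ─′ v1 ⊃ v0 ∊ v2 ∧ (v0 ∊ v1 ⊃ ⊥′))))) λ A B x → ─⁻ {S = A} {B}

    0≤∣_∣ : ∀ (D : Internal d) → ⋆ (+ 0) ≤* ∣ D ∣
    0≤∣_∣ = tr (all′ S (lit (+ 0) ≤′ card′ v0)) λ D → ≤⁺ (0≤card D)

    ∣∅∣≡0 : ∀ (D : Internal d) → (∀ x → ¬ x ∈ D) → ∣ D ∣ ≡ ⋆ (+ 0)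
    ∣∅∣≡0 = tr (all′ S (all′ (ι ^ d) (v0 ∊ v1 ⊃ ⊥′) ⊃ card′ v0 ≐ lit (+ 0))) λ D → card-∅

    1≤∣box∣ : ∀ (x : *ℤ^ d) ν → ⋆ (+ 1) ≤* ν → ⋆ (+ 1) ≤* ∣ *box x ν ∣
    1≤∣box∣ = tr (all′ (ι ^ d) (all′ ι (lit (+ 1) ≤′ v0 ⊃ lit (+ 1) ≤′ card′ (box′ v1 v0)))) λ x ν p →
      ≤⁺ (1≤card-box {x = x} (≤⁻ (+ 1) ν p))

    ∣∣≤∣box∣ : ∀ (x : *ℤ^ d) ν → ⋆ (+ 1) ≤* ν → ∀ A → A ⊆* *box x ν → ∣ A ∣ ≤* ∣ *box x ν ∣
    ∣∣≤∣box∣ = tr (all′ (ι ^ d) (all′ ι (lit (+ 1) ≤′ v0 ⊃ all′ S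
        (v1 ⊑′ box′ v3 v2 ⊃ card′ v0 ≤′ card′ (box′ v2 v1))))) λ x ν p A A⊑ →
      ≤⁺ (card-mono {x = x} (≤⁻ (+ 1) ν p) {A} {box x ν} A⊑ (λ _ → id) A⊑)

    ∣∪∣≤ : ∀ (x : *ℤ^ d) ν → ⋆ (+ 1) ≤* ν → ∀ A B → A ⊆* *box x ν → B ⊆* *box x ν → ∣ A ∪* B ∣ ≤* ∣ A ∣ +* ∣ B ∣
    ∣∪∣≤ = tr (all′ (ι ^ d) (all′ ι (lit (+ 1) ≤′ v0 ⊃ all′ S (all′ S (v2 ⊑′ box′ v4 v3 ⊃ v1 ⊑′ box′ v4 v3 ⊃
        card′ (v1 ⊔′ v0) ≤′ card′ v1 +′ card′ v0))))) λ x ν p A B A⊑ B⊑ →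
      ≤⁺ (card-⊔ {x = x} (≤⁻ (+ 1) ν p) {A} {B} A⊑ B⊑)

    ∣∣≤∣∖∣ : ∀ (x : *ℤ^ d) ν → ⋆ (+ 1) ≤* ν → ∀ A B → A ⊆* *box x ν → B ⊆* *box x ν → ∣ A ∣ ≤* ∣ B ∣ +* ∣ A ∖* B ∣
    ∣∣≤∣∖∣ = tr (all′ (ι ^ d) (all′ ι (lit (+ 1) ≤′ v0 ⊃ all′ S (all′ S (v2 ⊑′ box′ v4 v3 ⊃ v1 ⊑′ box′ v4 v3 ⊃
        card′ v1 ≤′ card′ v0 +′ card′ (v1 ─′ v0)))))) λ x ν p A B A⊑ B⊑ →
      ≤⁺ (card-─ {x = x} (≤⁻ (+ 1) ν p) {A} {B} A⊑ B⊑)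

    -- For standard `N` and `k` these compare the ratio |E + [-u , u]ᵈ| / |[-H , H]ᵈ| with `k / N`.
    -- They are internal conditions on `u`, which a condition on its standard part would not be, and
    -- so are open to overspill.
    Reaches Misses : ℕ → Internal d → *ℤ → ℕ → *ℤ → Set
    Reaches N E H k u = ⋆ (+ k) ** ∣ *box (origin {d}) H ∣ ≤* ⋆ (+ N) ** ∣ dil* E u ∣
    Misses  N E H k u = ⋆ (+ N) ** ∣ dil* E u ∣ <* ⋆ (+ k) ** ∣ *box (origin {d}) H ∣

    private
      module _ {Γ : List Ty} where

        reaches′ misses′ : ℕ → Term Γ S → Term Γ ι → ℕ → Term Γ ι → Formula Γ
        reaches′ N E H k u = lit (+ k) *′ card′ (box′ 𝟎′ H) ≤′ lit (+ N) *′ card′ (dil′ E u)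
        misses′  N E H k u = lit (+ N) *′ card′ (dil′ E u) <′ lit (+ k) *′ card′ (box′ 𝟎′ H)

    reaches-0 : ∀ N E H u → Reaches N E H 0 u
    reaches-0 N = tr (all′ S (all′ ι (all′ ι (reaches′ N v2 v1 0 v0)))) λ E H u →
      ≤⁺ (ℤ.≤-trans (ℤ.≤-reflexive (sym (ℤ.*-zeroʳ (+ N)))) (ℤ.*-monoˡ-≤-nonNeg (+ N) (0≤card (dil E u))))

    misses-max : ∀ N E H u → E ⊆* *box origin H → ⋆ (+ 1) ≤* u → u ≤* H → Misses N E H (suc (N ℕ.* 2 ℕ.^ d)) u
    misses-max N = tr (all′ S (all′ ι (all′ ι (v3 ⊑′ box′ 𝟎′ v2 ⊃ lit (+ 1) ≤′ v0 ⊃ v0 ≤′ v1 ⊃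
        misses′ N v2 v1 (suc (N ℕ.* 2 ℕ.^ d)) v0)))) λ E H u E⊑ p q →
      <⁺ (card-dil-bounded N {E} E⊑ (≤⁻ (+ 1) u p) (≤⁻ u H q))

    -- The `v` found is the end of the run of `Misses` that starts at 1. If `Misses` holds
    -- throughout a cut in `[1 , H]`, this `v` lies beyond the cut: `H` is not in it, and with `v`
    -- it would also contain `v + 1`, where `Misses` fails.
    overspill : ∀ N k E H → Misses N E H k (⋆ (+ 1)) → ⋆ (+ 1) ≤* H →
                ∃[ v ] (⋆ (+ 1) ≤* v × v ≤* H × Misses N E H k v × (v ≡ H ⊎ ¬ Misses N E H k (v +* ⋆ (+ 1))))
    overspill N k = tr (all′ S (all′ ι (misses′ N v1 v0 k (lit (+ 1)) ⊃ lit (+ 1) ≤′ v0 ⊃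
        ex′ ι (lit (+ 1) ≤′ v0 ∧ v0 ≤′ v1 ∧ misses′ N v2 v1 k v0 ∧
            (v0 ≐ v1 ∨ (misses′ N v2 v1 k (v0 +′ lit (+ 1)) ⊃ ⊥′))))))
      λ E H R1 p →
        let (v , 1≤v , v≤H , R , last) = last-below
              (λ v → T ⌊ + N ℤ.* card lem (dil E v) ℤ.<? + k ℤ.* card lem (box (𝟎 {d}) H) ⌋) R1 (≤⁻ (+ 1) H p)
        in v , ≤⁺ 1≤v , ≤⁺ v≤H , R , last

    ∣bad∣≤ : ∀ k m ε → 0ℚ ℚ.< ε → ∀ E H u v → E ⊆* *box origin H → ⋆ (+ 1) ≤* u → u ≤* v → v ≤* H →
             let N = 2 ℕ.^ d ℕ.* (m ℕ.* ℚ.↧ₙ ε) in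
             Reaches N E H k u → Misses N E H (suc k) v → ε ≥[ ∣ bad* m E u v H ∣ / ∣ *box (origin {d}) H ∣ ]
    ∣bad∣≤ k m ε@record{} 0<ε = tr (all′ S (all′ ι (all′ ι
        (all′ ι (v4 ⊑′ box′ 𝟎′ v3 ⊃ lit (+ 1) ≤′ v1 ⊃ v1 ≤′ v0 ⊃ v0 ≤′ v2 ⊃
        reaches′ N v3 v2 k v1 ⊃ misses′ N v3 v2 (suc k) v0 ⊃
        card′ (bad′ m v3 v1 v0 v2) *′ lit (↧ ε) ≤′ lit (↥ ε) *′ card′ (box′ 𝟎′ v2))))))
      λ E H u v E⊑ p q r reaches misses →
        ≤⁺ (card-bad k m (ℚ.↧ₙ ε) {E = E} E⊑ (1≤↥ 0<ε) (≤⁻ (+ 1) u p) (≤⁻ u v q) (≤⁻ v H r)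
          (≤⁻ (+ k ℤ.* card lem (box (𝟎 {d}) H)) (+ N ℤ.* card lem (dil E u)) reaches)
          (<⁻ (+ N ℤ.* card lem (dil E v)) (+ suc k ℤ.* card lem (box (𝟎 {d}) H)) misses))
      where
      N = 2 ℕ.^ d ℕ.* (m ℕ.* ℚ.↧ₙ ε)
      1≤↥ : ∀ {p} → 0ℚ ℚ.< p → + 1 ℤ.≤ ↥ p
      1≤↥ {mkℚ (+ suc n) _ _} _ = ℤ.+≤+ (ℕ.s≤s ℕ.z≤n)
      1≤↥ {mkℚ (+ zero)  _ _} (ℚ.*<* (ℤ.+<+ ()))
      1≤↥ {mkℚ -[1+ n ]  _ _} (ℚ.*<* ())

    bad*⊆ : ∀ m E u v H → bad* m E u v H ⊆* *box (origin {d}) H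
    bad*⊆ m = tr (all′ S (all′ ι (all′ ι (all′ ι (bad′ m v4 v3 v2 v1 ⊑′ box′ 𝟎′ v1))))) λ E u v H x → proj₁ ∘ ⌊⌋⁻

    bad*⁺ : ∀ k E H x e w u ξ ν v → x ∈ *box origin H → e ∈ E → x ≡ e ⊕ w →
            (∀ i → -* ξ ≤* coord i w × coord i w ≤* ξ) → ⋆ (+ 1) ≤* ν → ν ≤* ξ → ξ +* ξ ≤* v →
            level k ≥[ ∣ near* E u x ν ∣ / ∣ *box x ν ∣ ] → x ∈ bad* (suc k) E u v H
    bad*⁺ k E H x e w u ξ ν v Fx Ee x≡ small = tr (all′ S
        (all′ ι (all′ (ι ^ d) (all′ (ι ^ d) (all′ (ι ^ d) (all′ ι (all′ ι (all′ ι (all′ ι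
        (v6 ∊ box′ 𝟎′ v7 ⊃ v5 ∊ v8 ⊃ v6 ≐ v5 ⊕′ v4 ⊃ ⋀ d small′ ⊃ lit (+ 1) ≤′ v1 ⊃ v1 ≤′ v2 ⊃ v2 +′ v2 ≤′ v0 ⊃
          card′ (near′ v8 v3 v6 v1) *′ lit (↧ level k) ≤′ lit (↥ level k) *′ card′ (box′ v6 v1) ⊃
          v6 ∊ bad′ (suc k) v8 v3 v0 v7))))))))))
      (λ E H x e w u ξ ν v Fx Ee x≡ small p q r sparse → bad⁺ k {E} {H} {x} {e} {w} {u} {ξ} Fx Ee x≡
        (λ i → let (a , b) = ⋀⁻ standard _ d small i in ≤⁻ (ℤ.- ξ) (Vec.lookup w i) a , ≤⁻ (Vec.lookup w i) ξ b)
        (≤⁻ (+ 1) ν p) (≤⁻ ν ξ q) (≤⁻ (ξ ℤ.+ ξ) v r)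
        (≤⁻ (card lem (near E u x ν) ℤ.* + suc k) (+ k ℤ.* card lem (box x ν)) sparse))
      E H x e w u ξ ν v Fx Ee x≡ (⋀⁺ structure _ d small)
      where
      small′ : Fin d → Formula (ι ∷ ι ∷ ι ∷ ι ∷ ι ^ d ∷ ι ^ d ∷ ι ^ d ∷ ι ∷ S ∷ [])
      small′ i = -′ v2 ≤′ coord′ i v4 ∧ coord′ i v4 ≤′ v2

    near*⁻ : ∀ E u x ν y → y ∈ near* E u x ν →
             y ∈ *box x ν × ∃[ e ] ∃[ w ] (e ∈ E × y ≡ e ⊕ w × (∀ i → -* u ≤* coord i w × coord i w ≤* u))
    near*⁻ E u x ν y y∈ =
      let (b , e , w , Ee , y≡ , small) = tr (all′ S (all′ ι (all′ (ι ^ d) (all′ ι (all′ (ι ^ d)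
              (v0 ∊ near′ v4 v3 v2 v1 ⊃ v0 ∊ box′ v2 v1 ∧ ex′ (ι ^ d)
                  (ex′ (ι ^ d) (v1 ∊ v6 ∧ v2 ≐ v1 ⊕′ v0 ∧ ⋀ d small′))))))))
            (λ E u x ν y y∈ → let (b , e , w , Ee , y≡ , small) = near⁻ {E = E} {u} {x} {y} {ν} y∈ in
              b , e , w , Ee , y≡ , ⋀⁺ standard _ d (λ i → ≤⁺ (proj₁ (small i)) , ≤⁺ (proj₂ (small i))))
            E u x ν y y∈
      in b , e , w , Ee , y≡ , ⋀⁻ structure _ d small
      where
      small′ : Fin d → Formula (ι ^ d ∷ ι ^ d ∷ ι ^ d ∷ ι ∷ ι ^ d ∷ ι ∷ S ∷ [])
      small′ i = -′ v5 ≤′ coord′ i v0 ∧ coord′ i v0 ≤′ v5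

-- Standard parts, outer measure and Loeb null sets.

last-true : ExcludedMiddle 0ℓ → (R : ℕ → Set) → R 0 → ∀ k → ¬ R k → ∃[ n ] (R n × ¬ R (suc n))
last-true lem R R0 zero    ¬R = contradiction R0 ¬R
last-true lem R R0 (suc k) ¬R with lem {R k}
... | yes Rk = k , Rk , ¬R
... | no ¬Rk = last-true lem R R0 k ¬Rk

partialSum-0ᴿ : ∀ n {q} → Below (partialSum (λ _ → 0ᴿ) n) q → q ℚ.< 0ℚ
partialSum-0ᴿ zero    q<0 = q<0
partialSum-0ᴿ (suc n) (a , b , pa , b<0 , q<a+b) = ℚ.<-trans q<a+b (ℚ.+-mono-< (partialSum-0ᴿ n pa) b<0)

-- The termwise losses `h k − h (k + 1)` telescope. For positive `h` every partial sum loses less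
-- than `h 0`, so no infinite series of errors has to be evaluated.
partialSum-shift : (h : ℕ → ℚ) (f g : ℕ → ℝ∞) →
  (∀ k q → Below (f k) q → Below (g k) (q ℚ.- (h k ℚ.- h (suc k)))) →
  ∀ n q → Below (partialSum f n) q → Below (partialSum g n) (q ℚ.- (h 0 ℚ.- h n))
partialSum-shift h f g f≤g zero    q q<0 = subst (ℚ._< 0ℚ)
    (sym (trans (cong (λ p → q ℚ.- p) (ℚ.+-inverseʳ (h 0))) (ℚ.+-identityʳ q))) q<0
partialSum-shift h f g f≤g (suc n) q (a , b , pa , pb , q<a+b) =
  a ℚ.- (h 0 ℚ.- h n) , b ℚ.- (h n ℚ.- h (suc n)) , partialSum-shift h f g f≤g n a pa , f≤g n b pb ,
  subst (q ℚ.- (h 0 ℚ.- h (suc n)) ℚ.<_) (sym ([a-[e-h]]+[b-[h-g]]≡[a+b]-[e-g] a b (h 0) (h n) (h (suc n))))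
    (ℚ.+-monoˡ-< (ℚ.- (h 0 ℚ.- h (suc n))) q<a+b)

module Measure (lem : ExcludedMiddle 0ℓ) (𝕌 : NonstandardUniverse) where

  open Nonstandard lem 𝕌
  open Transferred lem 𝕌

  st-0 : ∀ {c q} → ⋆ (+ 1) ≤* c → Below st[ ⋆ (+ 0) / c ] q → q ℚ.< 0ℚ
  st-0 1≤c ((r , r≤) , q<r) = ℚ.<-≤-trans q<r (ℚ.≮⇒≥ λ 0<r → ratio*≤0 r 0<r _ 1≤c r≤)

  st-sub : ∀ {ε x a b c q} → x ≤* a +* b → ε ≥[ a / c ] → Below st[ x / c ] q → Below st[ b / c ] (q ℚ.- ε)
  st-sub {ε} x≤a+b a≤ε ((r , r≤) , q<r) = (r ℚ.- ε , sub-ratio* r ε _ _ _ _ r≤ x≤a+b a≤ε) , ℚ.+-monoˡ-< (ℚ.- ε) q<r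

  -- Given `q < r ≤ x / c`, take a mesh `δ < r − q`. Because `0 ≤ a / c ≤ 1`, some grid point `s`
  -- satisfies `s ≤ a / c ≤ s + δ`. Then `b / c ≥ r − (s + δ)`, and the two lower bounds add up to
  -- `r − δ > q`.
  st-+ : ∀ {x a b c q} → ⋆ (+ 1) ≤* c → ⋆ (+ 0) ≤* a → a ≤* c → x ≤* a +* b →
         Below st[ x / c ] q → Below (st[ a / c ] +ᴿ st[ b / c ]) q
  st-+ {x} {a} {b} {c} {q} 1≤c 0≤a a≤c x≤a+b ((r , r≤) , q<r) =
    let (δ , 0<δ , δ<r-q) = ℚ.<-dense (p<q⇒0<q-p q<r)
        (K , 1<Kδ) = archimedean 0<δ
        (k , kδ≤ , ¬k′δ≤) = last-true lem (λ k → multiples δ k ≤[ a / c ]) (0≤ratio* a c 0≤a) K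
          (ratio*≤1 (multiples δ K) 1<Kδ a c 1≤c a≤c)
        s = multiples δ k
        q<r-δ = subst (ℚ._< r ℚ.- δ) (q-[q-p]≡p q r) (ℚ.+-monoʳ-< r (ℚ.neg-antimono-< δ<r-q))
        (α , β , α<s , β<t , q<α+β) = split-< {q} {s} {r ℚ.- (s ℚ.+ δ)}
          (subst (q ℚ.<_) (sym (q+[r-[q+p]]≡r-p δ s r)) q<r-δ)
        s′≥ = [ ⊥-elim ∘ ¬k′δ≤ , id ]′ (≤*-total (⋆ (↥ (s ℚ.+ δ)) ** c) (a ** ⋆ (↧ (s ℚ.+ δ))))
    in α , β , ((s , kδ≤) , α<s) , ((_ , sub-ratio* r (s ℚ.+ δ) x a b c r≤ x≤a+b s′≥) , β<t) , q<α+β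

  <0⇒Below-series : ∀ (f : ℕ → ℝ∞) {q} → q ℚ.< 0ℚ → Below (series f) q
  <0⇒Below-series f q<0 = 0 , q<0

  module _ {d : ℕ} where

    <0⇒Below-μ : ∀ {F : Internal d} {A q} → q ℚ.< 0ℚ → Below (μ F A) q
    <0⇒Below-μ q<0 = let (r , q<r , r<0) = ℚ.<-dense q<0 in
      r , q<r , λ c → <0⇒Below-series (λ k → st[ ∣ Cover.set c k ∣ / _ ]) r<0

    μ-mono : ∀ {F : Internal d} {A B q} → (∀ x → A x → B x) → Below (μ F A) q → Below (μ F B) q
    μ-mono A⊆B (r , q<r , below) = r , q<r , λ c → below record
      { set    = Cover.set c
      ; inside = Cover.inside c
      ; covers = λ x (Fx , Ax) → Cover.covers c x (Fx , A⊆B x Ax)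
      }

    module _ (x : *ℤ^ d) (ν : *ℤ) (1≤ν : ⋆ (+ 1) ≤* ν) where

      private
        F = *box x ν

      -- By saturation, countably many internal sets that cover an internal set
      -- contain a finite subcover, so finite subadditivity suffices.
      module _ {A : Pred (*ℤ^ d) 0ℓ} (G : Internal d) (G⊆F : G ⊆* F) (G⊆A : ∀ y → y ∈ G → A y)
          (c : Cover F A) where

        private
          C = Cover.set c
          f = λ k → st[ ∣ C k ∣ / ∣ F ∣ ]

        remainder : ℕ → Internal d
        remainder zero    = G
        remainder (suc k) = remainder k ∖* C k

        remainder-suc⊆ : ∀ k → remainder (suc k) ⊆* remainder k
        remainder-suc⊆ k y = proj₁ ∘ ∖*⁻ (remainder k) (C k) y

        remainder-anti : ∀ {k n} → k ℕ.≤′ n → remainder n ⊆* remainder k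
        remainder-anti ℕ.≤′-refl         y y∈ = y∈
        remainder-anti (ℕ.≤′-step k≤n) y y∈ = remainder-anti k≤n y (remainder-suc⊆ _ y y∈)

        remainder⊆F : ∀ k → remainder k ⊆* F
        remainder⊆F k y = G⊆F y ∘ remainder-anti {0} {k} (ℕ.≤⇒≤′ ℕ.z≤n) y

        remainder-empty : ∃[ n ] (∀ y → ¬ y ∈ remainder n)
        remainder-empty = decidable-stable lem λ ¬empty →
          let (y , y∈) = saturation remainder λ n →
                let (y , y∈) = decidable-stable lem λ none → ¬empty (n , λ y y∈ → none (y , y∈))
                in y , λ k k≤n → remainder-anti (ℕ.≤⇒≤′ k≤n) y y∈
              (k , y∈Ck) = Cover.covers c y (G⊆F y (y∈ 0) , G⊆A y (y∈ 0))
          in proj₂ (∖*⁻ (remainder k) (C k) y (y∈ (suc k))) y∈Ck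

        Below-partialSum : ∀ n {q} → Below st[ ∣ G ∣ / ∣ F ∣ ] q →
                           Below (partialSum f n +ᴿ st[ ∣ remainder n ∣ / ∣ F ∣ ]) q
        Below-partialSum zero {q} ((r , r≤) , q<r) =
          let (a , b , a<0 , b<r , q<a+b) = split-< {q} {0ℚ} {r} (subst (q ℚ.<_) (sym (ℚ.+-identityˡ r)) q<r)
          in a , b , a<0 , ((r , r≤) , b<r) , q<a+b
        Below-partialSum (suc n) {q} p =
          let (a , b , pa , pb , q<a+b) = Below-partialSum n p
              (a′ , b′ , pa′ , pb′ , b<a′+b′) = st-+ (1≤∣box∣ x ν 1≤ν) 0≤∣ C n ∣
                (∣∣≤∣box∣ x ν 1≤ν (C n) (Cover.inside c n))
                (∣∣≤∣∖∣ x ν 1≤ν (remainder n) (C n) (remainder⊆F n) (Cover.inside c n)) pb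
              q<b′+[a+a′] = subst (q ℚ.<_) (trans (sym (ℚ.+-assoc a a′ b′)) (ℚ.+-comm (a ℚ.+ a′) b′))
                  (ℚ.<-trans q<a+b (ℚ.+-monoʳ-< a b<a′+b′))
              (α , q-b′<α , α<a+a′) = ℚ.<-dense (p<q+r⇒p-q<r {q} {b′} q<b′+[a+a′])
          in α , b′ , (a , a′ , pa , pa′ , α<a+a′) , pb′ , subst (q ℚ.<_) (ℚ.+-comm b′ α)
              (p-q<r⇒p<q+r {q} {b′} {α} q-b′<α)

        Below-series : ∀ {q} → Below st[ ∣ G ∣ / ∣ F ∣ ] q → Below (series f) q
        Below-series {q} p =
          let (n , empty) = remainder-empty
              (a , b , pa , pb , q<a+b) = Below-partialSum n p
              b<0 = st-0 (1≤∣box∣ x ν 1≤ν) (subst (λ z → Below st[ z / ∣ F ∣ ] b) (∣∅∣≡0 (remainder n) empty) pb)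
          in n , down (partialSum f n) (ℚ.<-trans q<a+b (subst (a ℚ.+ b ℚ.<_) (ℚ.+-identityʳ a)
              (ℚ.+-monoʳ-< a b<0))) pa

      μ-lower : ∀ {A : Pred (*ℤ^ d) 0ℓ} (G : Internal d) → G ⊆* F → (∀ y → y ∈ G → A y) →
                -- The gap between `r` and `s` leaves room twice: `inf` needs one rational above `r`
                -- that serves every cover, and this must lie strictly below `s` to be below the
                -- standard part.
                ∀ {r s} → s ≤[ ∣ G ∣ / ∣ F ∣ ] → r ℚ.< s → Below (μ F A) r
      μ-lower G G⊆F G⊆A {r} {s} s≤ r<s = let (t , r<t , t<s) = ℚ.<-dense r<s in
        t , r<t , λ c → Below-series G G⊆F G⊆A c ((s , s≤) , t<s)

      record SmallCover (A : Pred (*ℤ^ d) 0ℓ) (ε : ℚ) : Set where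
        field
          cover  : Cover F A
          h      : ℕ → ℚ
          h₀     : h 0 ≡ ε
          0<h    : ∀ k → 0ℚ ℚ.< h k
          small  : ∀ k → (h k ℚ.- h (suc k)) ≥[ ∣ Cover.set cover k ∣ / ∣ F ∣ ]

      -- Sets Y k of measure at most ε may be prescribed for every ε, so the k-th
      -- one is given the share h k − h (k + 1) of ε for a decreasing h > 0.
      small-cover : ∀ {A : Pred (*ℤ^ d) 0ℓ} (Q : ℕ → Pred (*ℤ^ d) 0ℓ) →
        (∀ x → x ∈ F → A x → ∃[ k ] Q k x) →
        (∀ k ε → 0ℚ ℚ.< ε → ∃[ Y ] (Y ⊆* F × ε ≥[ ∣ Y ∣ / ∣ F ∣ ] × (∀ x → x ∈ F → Q k x → x ∈ Y))) →
        ∀ ε → 0ℚ ℚ.< ε → SmallCover A ε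
      small-cover {A} Q A⊆Q Y ε 0<ε = record
        { cover = record
          { set    = λ k → proj₁ (Y′ k)
          ; inside = λ k → proj₁ (proj₂ (Y′ k))
          ; covers = λ x (Fx , Ax) → let (k , q) = A⊆Q x Fx Ax in k , proj₂ (proj₂ (proj₂ (Y′ k))) x Fx q
          }
        ; h = proj₁ ∘ H ; h₀ = refl ; 0<h = proj₂ ∘ H ; small = λ k → proj₁ (proj₂ (proj₂ (Y′ k)))
        }
        where
        H : ℕ → ∃[ q ] 0ℚ ℚ.< q
        H zero    = ε , 0<ε
        H (suc k) = let (r , 0<r , _) = ℚ.<-dense (proj₂ (H k)) in r , 0<r
        H-dec : ∀ k → proj₁ (H (suc k)) ℚ.< proj₁ (H k)
        H-dec k = proj₂ (proj₂ (ℚ.<-dense (proj₂ (H k))))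
        Y′ = λ k → Y k (proj₁ (H k) ℚ.- proj₁ (H (suc k))) (p<q⇒0<q-p (H-dec k))

      module _ {A : Pred (*ℤ^ d) 0ℓ} (small-covers : ∀ ε → 0ℚ ℚ.< ε → SmallCover A ε) where

        μ≈0 : μ F A ≈ᴿ 0ᴿ
        μ≈0 q = mk⇔ to <0⇒Below-μ
          where
          to : Below (μ F A) q → q ℚ.< 0ℚ
          to (r , q<r , below) = ℚ.<-≤-trans q<r (ℚ.≮⇒≥ λ 0<r → absurd 0<r)
            where
            absurd : 0ℚ ℚ.< r → ⊥
            -- Take the small cover of total size `r`. If `r` were below its `n`-th partial sum,
            -- telescoping would leave `r − (r − h n) = h n` below a sum of zeros.
            absurd 0<r = ℚ.<-asym (0<h n) (subst (ℚ._< 0ℚ)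
                (trans (cong (λ p → r ℚ.- (p ℚ.- h n)) h₀) (q-[q-p]≡p (h n) r))
              (partialSum-0ᴿ n (partialSum-shift h _ (λ _ → 0ᴿ) (λ k p b → st-0 (1≤∣box∣ x ν 1≤ν)
                (st-sub (subst (∣ Cover.set cover k ∣ ≤*_) (sym (+*-identityʳ _)) (≤*-refl _))
                    (small k) b)) n r bn)))
              where
              open SmallCover (small-covers r 0<r)
              n = proj₁ (below cover)
              bn = proj₂ (below cover)

        -- One inequality follows from `μ F A ≈ᴿ 0ᴿ` and monotonicity. For the other, a cover of
        -- `B ∖ A` is merged term by term with a small cover of `A` into a cover of `B`, and the
        -- extra cost is arbitrarily small.
        measurable : LoebMeasurable F A
        measurable B q = mk⇔ to from
          where
          from : Below (μ F (B ∩ A) +ᴿ μ F (B ∖ A)) q → Below (μ F B) q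
          from (a , b , pa , pb , q<a+b) = down (μ F B) (ℚ.<-trans q<a+b
            (subst (a ℚ.+ b ℚ.<_) (ℚ.+-identityˡ b) (ℚ.+-monoˡ-< b
                (Equivalence.to (μ≈0 a) (μ-mono (λ _ → proj₂) pa)))))
            (μ-mono (λ _ → proj₁) pb)

          to : Below (μ F B) q → Below (μ F (B ∩ A) +ᴿ μ F (B ∖ A)) q
          to (r , q<r , below) =
            let (s , q<s , s<r) = ℚ.<-dense q<r
                (t , s<t , t<r) = ℚ.<-dense s<r
                (a , q-s<a , a<0) = ℚ.<-dense (subst (q ℚ.- s ℚ.<_) (ℚ.+-inverseʳ s) (ℚ.+-monoˡ-< (ℚ.- s) q<s))
            in a , s , <0⇒Below-μ a<0 , (t , s<t , bound t t<r) ,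
               subst (q ℚ.<_) (ℚ.+-comm s a) (p-q<r⇒p<q+r {q} {s} {a} q-s<a)
            where
            bound : ∀ t → t ℚ.< r → ∀ c → Below (series λ k → st[ ∣ Cover.set c k ∣ / ∣ F ∣ ]) t
            bound t t<r c = n , down (partialSum _ n) t<r-[ε-h]
              (partialSum-shift h _ _ (λ k p b → st-sub
                (∣∪∣≤ x ν 1≤ν (Cover.set cover k) (Cover.set c k) (Cover.inside cover k) (Cover.inside c k))
                    (small k) b) n r bn)
              where
              -- With `ε = r − t`, the first `n` merged terms cost at most `ε − h n < r − t` extra,
              -- so `t` remains below the partial sum for `c` alone.
              open SmallCover (small-covers (r ℚ.- t) (p<q⇒0<q-p t<r))
              both : Cover F B
              both = record
                { set    = λ k → Cover.set cover k ∪* Cover.set c k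
                ; inside = λ k y → [ Cover.inside cover k y , Cover.inside c k y ]′ ∘ ∪*⁻ _ _ y
                ; covers = λ y (Fy , By) → covers y Fy By (lem {A y})
                }
                where
                covers : ∀ y → y ∈ F → B y → Dec (A y) → ∃[ k ] y ∈ (Cover.set cover k ∪* Cover.set c k)
                covers y Fy By (yes Ay) = let (k , y∈) = Cover.covers cover y (Fy , Ay) in k , ∪*⁺ _ _ y (inj₁ y∈)
                covers y Fy By (no ¬Ay) = let (k , y∈) = Cover.covers c y (Fy , By , ¬Ay)
                    in k , ∪*⁺ _ _ y (inj₂ y∈)
              n = proj₁ (below both)
              bn = proj₂ (below both)
              t<r-[ε-h] : t ℚ.< r ℚ.- (h 0 ℚ.- h n)
              t<r-[ε-h] rewrite h₀ = subst (ℚ._< r ℚ.- ((r ℚ.- t) ℚ.- h n)) (q-[q-p]≡p t r)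
                (ℚ.+-monoʳ-< r (ℚ.neg-antimono-< (p-q<p {r ℚ.- t} (0<h n))))

        null : LoebNull F A
        null = measurable , μ≈0

-- Cuts, stabilisation beyond a cut, and covers of the exceptional set.

module CutDensity (lem : ExcludedMiddle 0ℓ) (𝕌 : NonstandardUniverse) (d : ℕ) where

  open Nonstandard lem 𝕌
  open Transferred lem 𝕌
  open Measure lem 𝕌

  module _ {H : *ℤ} {U : Pred *ℤ 0ℓ} (cut : IsCut H U) where
    open IsCut cut

    1∈U : U (⋆ (+ 1))
    1∈U = let (u , Uu) = nonempty in initial Uu (≤*-refl _) (proj₁ (bounded Uu))

    ∉⇒>ᶜ : ∀ {v} → ⋆ (+ 1) ≤* v → ¬ U v → v >ᶜ U
    ∉⇒>ᶜ {v} 1≤v v∉U u Uu = [ ⊥-elim ∘ v∉U ∘ initial Uu 1≤v , id ]′ (≤*-<*-connex v u)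

    >ᶜ⇒∉ : ∀ {v} → v >ᶜ U → ¬ U v
    >ᶜ⇒∉ {v} v>U Uv = <*⇒≱* v v (v>U v Uv) (≤*-refl v)

    H∉U : ⋆ (+ 1) ≤* H → ¬ U H
    H∉U 1≤H UH = double≰* H 1≤H (proj₂ (bounded (closed UH UH)))

    -- Were the rounded half `ξ` in `U`, closure under addition would put `2ξ + 1` there, and with
    -- it `v ≤ 2ξ + 1`.
    half>U : ∀ v → v >ᶜ U → ∃[ ξ ] (⋆ (+ 1) ≤* ξ × ξ >ᶜ U × ξ +* ξ ≤* v)
    half>U v v>U =
      let 1<v = v>U _ 1∈U
          (ξ , 1≤ξ , 2ξ≤v , v≤2ξ+1) = half* v 1<v
      in ξ , 1≤ξ , ∉⇒>ᶜ 1≤ξ (λ Uξ → >ᶜ⇒∉ v>U (initial (closed (closed Uξ Uξ) 1∈U) (<*⇒≤* _ _ 1<v) v≤2ξ+1)) , 2ξ≤v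

    𝒰⇒∣∣≤ : ∀ {ξ z} → ⋆ (+ 1) ≤* ξ → ξ >ᶜ U → 𝒰 U z → -* ξ ≤* z × z ≤* ξ
    𝒰⇒∣∣≤ {ξ} 1≤ξ ξ>U (inj₁ (u , Uu , refl))  = ∣-u∣≤* u ξ (proj₁ (bounded Uu)) (ξ>U u Uu)
    𝒰⇒∣∣≤ {ξ} 1≤ξ ξ>U (inj₂ (inj₁ refl))      = ∣0∣≤* ξ 1≤ξ
    𝒰⇒∣∣≤ {ξ} 1≤ξ ξ>U (inj₂ (inj₂ Uz))        = ∣u∣≤* _ ξ (proj₁ (bounded Uz)) (ξ>U _ Uz)

    ∣∣≤⇒𝒰 : ∀ {u z} → U u → -* u ≤* z → z ≤* u → 𝒰 U z
    ∣∣≤⇒𝒰 {u} {z} Uu -u≤z z≤u with sign-cases* z u -u≤z z≤u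
    ... | inj₁ (1≤-z , -z≤u , z≡) = inj₁ (-* z , initial Uu 1≤-z -z≤u , z≡)
    ... | inj₂ (inj₁ z≡0)         = inj₂ (inj₁ z≡0)
    ... | inj₂ (inj₂ 1≤z)         = inj₂ (inj₂ (initial Uu 1≤z z≤u))

    module _ (1≤H : ⋆ (+ 1) ≤* H) (E : Internal d) (E⊆F : E ⊆* *box origin H) where

      private
        F = *box (origin {d}) H

      -- As N |E + [-u , u]ᵈ| / |[-H , H]ᵈ| is finite, its integer part has a
      -- largest value k on U; by overspill the value k persists beyond U.
      stabilises : ∀ N → ∃[ k ] ∃[ u ] ∃[ v ] (U u × v >ᶜ U × v ≤* H × Reaches N E H k u × Misses N E H (suc k) v)
      stabilises N = max (N ℕ.* 2 ℕ.^ d) λ u Uu → misses-max N E H u E⊆F (proj₁ (bounded Uu)) (proj₂ (bounded Uu))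
        where
        beyond : ∀ k → (∀ u → U u → Misses N E H (suc k) u) → ∃[ v ] (v >ᶜ U × v ≤* H × Misses N E H (suc k) v)
        beyond k misses with overspill N (suc k) E H (misses _ 1∈U) 1≤H
        ... | v , 1≤v , v≤H , miss , inj₁ refl = v , ∉⇒>ᶜ 1≤v (H∉U 1≤H) , v≤H , miss
        ... | v , 1≤v , v≤H , miss , inj₂ last = v , ∉⇒>ᶜ 1≤v (λ Uv → last (misses _ (closed Uv 1∈U))) , v≤H , miss

        -- Descends on `k` while no `u` in `U` reaches `k + 1`. The descent stops at 0 at the
        -- latest, since 0 is always reached.
        max : ∀ k → (∀ u → U u → Misses N E H (suc k) u) →
              ∃[ k ] ∃[ u ] ∃[ v ] (U u × v >ᶜ U × v ≤* H × Reaches N E H k u × Misses N E H (suc k) v)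
        max k misses with lem {∃[ u ] (U u × Reaches N E H k u)}
        ... | yes (u , Uu , reach) = let (v , v>U , v≤H , miss) = beyond k misses
            in k , u , v , Uu , v>U , v≤H , reach , miss
        max zero misses    | no ¬reach = let (u , Uu) = nonempty
            in contradiction (u , Uu , reaches-0 N E H u) ¬reach
        max (suc k) misses | no ¬reach = max k λ u Uu →
            [ (λ reach → contradiction (u , Uu , reach) ¬reach) , id ]′ (≤*-<*-connex _ _)

      near⊆ : ∀ u x ν → U u → ∀ y → y ∈ near* E u x ν → ((E +𝒰[ U ]) ∩ ⟪ *box x ν ⟫) y
      near⊆ u x ν Uu y y∈ = let (b , e , w , Ee , y≡ , small) = near*⁻ E u x ν y y∈ in
        (e , w , Ee , (λ i → ∣∣≤⇒𝒰 Uu (proj₁ (small i)) (proj₂ (small i))) , y≡) , b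

      -- The given `ξ` is one competitor in the supremum defining the liminf, so the infimum over
      -- `U < ν < ξ` is no larger than the density. This yields a radius below that very `ξ`; moving
      -- from `q` to `r` accounts for the strict inequality inside `inf`.
      density<⇒sparse : ∀ {x ξ q r} → ⋆ (+ 1) ≤* ξ → ξ >ᶜ U → ¬ Below (density E U x) q → q ℚ.< r →
        ∃[ ν ] (⋆ (+ 1) ≤* ν × ν <* ξ × ¬ Below (μ (*box x ν) ((E +𝒰[ U ]) ∩ ⟪ *box x ν ⟫)) r)
      density<⇒sparse {x} {ξ} {q} {r} 1≤ξ ξ>U ¬below q<r = decidable-stable lem λ none → ¬below
        ((ξ , 1≤ξ , ξ>U) , r , q<r , λ (ν , 1≤ν , _ , ν<ξ) → decidable-stable lem λ ¬b → none (ν , 1≤ν , ν<ξ , ¬b))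

      SparseAt : ℕ → Pred (*ℤ^ d) 0ℓ
      SparseAt k x = (E +𝒰[ U ]) x × ∃[ q ] (¬ Below (density E U x) q × q ℚ.< level k)

      sparse-cover : ∀ k ε → 0ℚ ℚ.< ε →
        ∃[ Y ] (Y ⊆* F × ε ≥[ ∣ Y ∣ / ∣ F ∣ ] × (∀ x → x ∈ F → SparseAt k x → x ∈ Y))
      sparse-cover k ε 0<ε =
        let (j , u , v , Uu , v>U , v≤H , reach , miss) = stabilises (2 ℕ.^ d ℕ.* (suc k ℕ.* ℚ.↧ₙ ε))
            (ξ , 1≤ξ , ξ>U , 2ξ≤v) = half>U v v>U
        in bad* (suc k) E u v H , bad*⊆ (suc k) E u v H ,
           ∣bad∣≤ j (suc k) ε 0<ε E H u v E⊆F (proj₁ (bounded Uu)) (<*⇒≤* u v (v>U u Uu)) v≤H reach miss ,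
           λ x Fx ((e , w , Ee , w∈𝒰 , x≡) , q , ¬below , q<level) →
             let (r , q<r , r<level) = ℚ.<-dense q<level
                 (ν , 1≤ν , ν<ξ , ¬belowν) = density<⇒sparse {x} 1≤ξ ξ>U ¬below q<r
                 near⊆A = near⊆ u x ν Uu
             in bad*⁺ k E H x e w u ξ ν v Fx Ee x≡ (λ i → 𝒰⇒∣∣≤ 1≤ξ ξ>U (w∈𝒰 i)) 1≤ν (<*⇒≤* ν ξ ν<ξ) 2ξ≤v
                  -- If the internal part filled at least `level k` of the box, `μ-lower` would put
                  -- `r < level k` below the measure, against the choice of `ν`.
                  ([ (λ dense → contradiction (μ-lower x ν 1≤ν (near* E u x ν)
                      (λ y y∈ → proj₂ (near⊆A y y∈)) near⊆A dense r<level) ¬belowν) , id ]′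
                    (≤*-total (⋆ (↥ (level k)) ** ∣ *box x ν ∣) (∣ near* E u x ν ∣ ** ⋆ (↧ (level k)))))

theorem6p2 : (lem : ExcludedMiddle 0ℓ) → (ext : Extensionality 0ℓ 0ℓ) →
    (𝕌 : NonstandardUniverse) →
    let open Nonstandard lem 𝕌 in
    (d : ℕ) → 1 ≤ d →
    (H : *ℤ) → IsInfiniteHypernatural H →
    (U : Pred *ℤ 0ℓ) → IsCut H U →
    (E : Internal d) → E ⊆* *box origin H →
    LoebNull (*box origin H) ((E +𝒰[ U ]) ∩ (λ x → density E U x <ᴿ 1ᴿ))
theorem6p2 lem ext 𝕌 d _ H (1≤H , _) U cut E E⊆F =
  null origin H 1≤H (small-cover origin H 1≤H (SparseAt cut 1≤H E E⊆F)
    (λ x _ (Ax , q , ¬below , q<1) → let (k , q<level) = <-level q<1 in k , Ax , q , ¬below , q<level)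
    (sparse-cover cut 1≤H E E⊆F))
  where
  open Nonstandard lem 𝕌
  open Measure lem 𝕌
  open CutDensity lem 𝕌 d
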